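{- Let $p$ be a prime, let $d \geq 1$ be an integer and let $A = \mathrm{Mat}_{d \times d}(\mathbf F_p)$. Given matrices $a, b, c \in A$, let $\mathcal M \colon \mathbf Z^2 \to A$ be the tiling recursively defined by the following conditions: $\mathcal M(0, 0) = 1$ (the identity matrix), $\mathcal M(m, n) = 0$ if $(m, n) \not \in \mathbf N^2$, and $$\mathcal M(m, n) = a \mathcal M(m-1, n) + b\mathcal M(m, n-1) + c \mathcal M(m-1, n-1)$$ if $(m, n) \in \mathbf N^2 \setminus \{(0, 0)\}$. Then there is a $2$-dimensional tiling $\overline{\mathcal T}\colon\mathbf Z^2\to A$ with color set $A$, invariant under a linear substitution of length $p$, and a linear map $\tau \colon A \to A$ such that $\mathcal M = \tau \circ \overline{\mathcal T}$.
   Context: $\mathbf F_p=\mathbf Z/p\mathbf Z$ and $\mathbf N$ is the set of non-negative integers. For sets $A,E$, $A^E$ denotes the set of all maps $E\to A$; if $A$ is an $\mathbf F_p$-vector space, so is $A^E$ (pointwise operations). "Linear" means $\mathbf F_p$-linear. A $2$-dimensional tiling with color set $A$ is a map $\mathcal T\colon\mathbf Z^2\to A$. A $2$-dimensional substitution of length $\ell\ge 1$ on $A$ is a map $\mathcal S\colon A\to A^{\mathcal I^2}$, $a\mapsto\mathcal S_a$, with $\mathcal I=\{0,\dots,\ell-1\}$. A tiling $\mathcal T\in A^{\mathbf Z^2}$ is invariant under $\mathcal S$ if $\mathcal T(\ell\boldsymbol{\alpha}+\boldsymbol{\beta})=\mathcal S_{\mathcal T(\boldsymbol{\alpha})}(\boldsymbol{\beta})$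 for all $\boldsymbol{\alpha}\in\mathbf Z^2$, $\boldsymbol{\beta}\in\mathcal I^2$. The substitution is linear if the map $\mathcal S\colon A\to A^{\mathcal I^2}$ is linear. -}

module Defs where

open import Algebra.Bundles.Raw using (RawRing)
open import Algebra.Definitions.RawMonoid using (sum)
open import Algebra.Module.Bundles.Raw using (RawLeftModule)
open import Algebra.Module.Morphism.Structures using (IsLeftModuleHomomorphism)
open import Data.Bool using (if_then_else_)
open import Data.Fin using (Fin; toℕ)
import Data.Fin.Properties as Fin
open import Data.Integer as ℤ using (ℤ; 0ℤ; 1ℤ; +_)
open import Data.Nat as ℕ using (ℕ; NonZero)
open import Data.Nat.DivMod using (_mod_)
open import Data.Product using (_×_; _,_)
open import Data.Vec using (Vec; lookup; map; replicate; tabulate; zipWith)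
open import Level using (Level; 0ℓ)
open import Relation.Binary.PropositionalEquality using (_≡_; _≢_)
open import Relation.Nullary using (¬_; does)

private
  variable
    a : Level

-- Z/pZ on the representatives 0, …, p − 1, so that equality is _≡_.
𝔽 : (p : ℕ) → .{{_ : NonZero p}} → RawRing 0ℓ 0ℓ
𝔽 p = record
  { Carrier = Fin p
  ; _≈_     = _≡_
  ; _+_     = λ x y → (toℕ x ℕ.+ toℕ y) mod p
  ; _*_     = λ x y → (toℕ x ℕ.* toℕ y) mod p
  ; -_      = λ x → (p ℕ.∸ toℕ x) mod p
  ; 0#      = 0 mod p
  ; 1#      = 1 mod p
  }

module Matrices (R : RawRing 0ℓ 0ℓ) where

  open RawRing R

  -- Matrices are stored as a vector of rows, so that (for R = 𝔽 p) two
  -- matrices with the same entries are propositionally equal.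
  Mat : ℕ → Set
  Mat d = Vec (Vec Carrier d) d

  module _ {d : ℕ} where

    infixl 6 _+ᴹ_
    infixl 7 _*ᴹ_
    infixr 7 _·_

    entry : Mat d → Fin d → Fin d → Carrier
    entry A i j = lookup (lookup A i) j

    matrix : (Fin d → Fin d → Carrier) → Mat d
    matrix f = tabulate (λ i → tabulate (f i))

    _+ᴹ_ : Mat d → Mat d → Mat d
    _+ᴹ_ = zipWith (zipWith _+_)

    -ᴹ_ : Mat d → Mat d
    -ᴹ_ = map (map -_)

    _·_ : Carrier → Mat d → Mat d
    r · A = map (map (r *_)) A

    _*ᴹ_ : Mat d → Mat d → Mat d
    A *ᴹ B = matrix λ i j → sum +-rawMonoid (λ k → entry A i k * entry B k j)

    0ᴹ : Mat d
    0ᴹ = replicate d (replicate d 0#)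

    1ᴹ : Mat d
    1ᴹ = matrix λ i j → if does (i Fin.≟ j) then 1# else 0#

  matrixModule : ℕ → RawLeftModule Carrier 0ℓ 0ℓ
  matrixModule d = record
    { Carrierᴹ = Mat d
    ; _≈ᴹ_     = _≡_
    ; _+ᴹ_     = _+ᴹ_
    ; _*ₗ_     = _·_
    ; 0ᴹ       = 0ᴹ
    ; -ᴹ_      = -ᴹ_
    }

-- The module A^E of all maps E → A, with pointwise operations and equality.
powerModule : {R : Set} → RawLeftModule R 0ℓ 0ℓ → Set → RawLeftModule R 0ℓ 0ℓ
powerModule A E = record
  { Carrierᴹ = E → Carrierᴹ
  ; _≈ᴹ_     = λ f g → ∀ x → f x ≈ᴹ g x
  ; _+ᴹ_     = λ f g x → f x +ᴹ g x
  ; _*ₗ_     = λ r f x → r *ₗ f x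
  ; 0ᴹ       = λ _ → 0ᴹ
  ; -ᴹ_      = λ f x → -ᴹ f x
  }
  where open RawLeftModule A

Tiling : Set a → Set a
Tiling A = ℤ × ℤ → A

Cell : ℕ → Set
Cell ℓ = Fin ℓ × Fin ℓ

Substitution : ℕ → Set a → Set a
Substitution ℓ A = A → (Cell ℓ → A)

infixl 6 _⊛_⊕_

-- ℓ ⊛ α ⊕ β  is the point ℓα + β of ℤ².
_⊛_⊕_ : (ℓ : ℕ) → ℤ × ℤ → Cell ℓ → ℤ × ℤ
ℓ ⊛ (m , n) ⊕ (i , j) =
  (+ ℓ ℤ.* m ℤ.+ + toℕ i , + ℓ ℤ.* n ℤ.+ + toℕ j)

Invariant : {A : Set a} (ℓ : ℕ) → Substitution ℓ A → Tiling A → Set a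
Invariant ℓ S T = ∀ α β → T (ℓ ⊛ α ⊕ β) ≡ S (T α) β

Linear : {R : Set} (A B : RawLeftModule R 0ℓ 0ℓ) →
         (RawLeftModule.Carrierᴹ A → RawLeftModule.Carrierᴹ B) → Set
Linear A B f = IsLeftModuleHomomorphism A B f

LinearSubstitution : {R : Set} (A : RawLeftModule R 0ℓ 0ℓ) (ℓ : ℕ) →
                     Substitution ℓ (RawLeftModule.Carrierᴹ A) → Set
LinearSubstitution A ℓ S = Linear A (powerModule A (Cell ℓ)) S

InQuadrant : ℤ × ℤ → Set
InQuadrant (m , n) = 0ℤ ℤ.≤ m × 0ℤ ℤ.≤ n

module _ (R : RawRing 0ℓ 0ℓ) {d : ℕ} where

  open Matrices R

  -- These conditions determine M at every point of ℤ².
  record RecursivelyDefined (a b c : Mat d) (M : Tiling (Mat d)) : Set where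
    field
      origin     : M (0ℤ , 0ℤ) ≡ 1ᴹ
      outside    : ∀ α → ¬ InQuadrant α → M α ≡ 0ᴹ
      recurrence : ∀ m n → InQuadrant (m , n) → (m , n) ≢ (0ℤ , 0ℤ) →
                   M (m , n) ≡ a *ᴹ M (m ℤ.- 1ℤ , n)
                               +ᴹ b *ᴹ M (m , n ℤ.- 1ℤ)
                               +ᴹ c *ᴹ M (m ℤ.- 1ℤ , n ℤ.- 1ℤ)

module Submission where

-- Over F_p[[x,y]] the generating series F of M satisfies (1 − ax − by − cxy) F = 1, so F = P/Q with
-- Q the determinant and P the adjugate of 1 − ax − by − cxy. The degree of Q in each variable is at
-- most d, that of the entries of P at most d − 1, and Q(0,0) = 1. As Q(x,y)^p = Q(x^p,y^p), the
-- coefficients of x^k y^l / Q = x^k y^l Q^(p−1) / Q^p at the points pα + β form the series R / Q,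
-- where R collects the coefficients of x^k y^l Q^(p−1) at the points pα + β. For k, l < d the
-- degrees of R are again less than d. Thus the d² series x^k y^l / Q, read as one tiling by d × d
-- matrices, are invariant under a linear substitution, and P expresses F linearly through them.

-- The matrices a, b, c need not commute, so the p-th power of 1 - ax - by - cxy has no simple form.
-- Frobenius applies only to a scalar denominator, which is why the determinant enters. The bounds
-- close up exactly. Each entry of 1 - ax - by - cxy has degree at most 1 in x and in y separately,
-- and a cofactor has one constant row, so it stays within the monomials x^k y^l with k, l < d: one
-- for each entry of a colour. Likewise x^k y^l Q^(p-1) has degree below d + (p-1)d = pd in each
-- variable, and keeping one coefficient in p brings this back below d. Polynomials are not a
-- separate type but power series with vanishing coefficients. Degree in x, degree in y and
-- compatibility with Frobenius all behave well under ring operations, so one induction over the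
-- exterior product serves all three.

open import Defs
open import Data.Nat using (ℕ; NonZero; _≥_)
open import Data.Nat.Primality using (Prime)
open import Data.Product using (Σ-syntax; _×_)
open import Function using (_∘_)
open import Relation.Binary.PropositionalEquality using (_≗_)
open Matrices using (Mat; matrixModule)

open import Algebra using (CommutativeRing; IsCommutativeRing)
open import Algebra.Bundles.Raw using (RawRing)
import Algebra.Construct.Pointwise as Pointwise
open import Algebra.Module.Bundles.Raw using (RawLeftModule)
import Algebra.Properties.CommutativeSemigroup as CommutativeSemigroupProperties
open import Data.Bool using (if_then_else_; true; false)
open import Data.Fin as Fin using (Fin; zero; suc; toℕ; fromℕ; inject₁)
import Data.Fin.Properties as Fin
open import Data.Fin.Subset using (Subset; inside; outside) renaming (⊤ to full)
open import Data.Nat as ℕ using (zero; suc; z≤n; s≤s; _∸_; _!)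
open import Data.Nat.Combinatorics using (_C_; nCn≡1; nCk≡n!/k![n-k]!; k![n∸k]!∣n!)
open import Data.Nat.Divisibility using (_∣_; _∤_; >⇒∤; m∣m*n; divides-refl)
open import Data.Nat.DivMod
open import Data.Nat.Primality using (euclidsLemma; prime⇒nonTrivial; prime⇒nonZero)
import Data.Nat.Properties as ℕ
open import Data.Product using (∃; _,_; proj₁; proj₂)
open import Data.Sum using ([_,_]′)
open import Data.Vec using (Vec; lookup; []; _∷_)
open import Data.Vec.Functional using (Vector; tail; updateAt)
open import Data.Vec.Properties
open import Function using (id)
open import Level as Level using (0ℓ; _⊔_)
import Relation.Binary.Reasoning.Setoid as SetoidReasoning
open import Relation.Binary.PropositionalEquality as ≡ using (_≡_; _≢_)
open import Relation.Nullary using (contradiction; does; ¬_; yes; no)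

-- Formal power series

-- Deg k stands for “degree at most k”; a family Deg that ignores k is just a subring.
record Filtration {c ℓ} (R : CommutativeRing c ℓ) r : Set (c ⊔ ℓ ⊔ Level.suc r) where
  open CommutativeRing R hiding (zero)
  field
    Deg     : ℕ → Carrier → Set r
    0-deg   : ∀ {k} → Deg k 0#
    1-deg   : ∀ {k} → Deg k 1#
    +-deg   : ∀ {k f g} → Deg k f → Deg k g → Deg k (f + g)
    neg-deg : ∀ {k f} → Deg k f → Deg k (- f)
    *-deg   : ∀ {k l f g} → Deg k f → Deg l g → Deg (k ℕ.+ l) (f * g)

  open import Algebra.Properties.Semiring.Exp semiring using (_^_)

  ^-deg : ∀ {k f} n → Deg k f → Deg (n ℕ.* k) (f ^ n)
  ^-deg zero    _ = 1-deg
  ^-deg (suc n) d = *-deg d (^-deg n d)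

module PowerSeries {c ℓ} (K : CommutativeRing c ℓ) where
  open CommutativeRing K hiding (zero)
  open SetoidReasoning setoid
  open CommutativeSemigroupProperties +-commutativeSemigroup using (x∙yz≈y∙xz; interchange)

  Series : Set c
  Series = ℕ → Carrier

  infix 4 _≋_
  _≋_ : Series → Series → Set ℓ
  f ≋ g = ∀ n → f n ≈ g n

  infixl 7 _⊛_
  -- The Cauchy product read off from f = f₀ + X f⁺, where f⁺ is `f ∘ suc`: the recursion is on the
  -- index alone and needs no finite sums.
  _⊛_ : Series → Series → Series
  (f ⊛ g) zero    = f 0 * g 0
  (f ⊛ g) (suc n) = f 0 * g (suc n) + (f ∘ suc ⊛ g) n

  const : Carrier → Series
  const k zero    = k
  const k (suc n) = 0#

  X : Series
  X zero    = 0#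
  X (suc n) = const 1# n

  ⊛-cong : ∀ {f f′ g g′} → f ≋ f′ → g ≋ g′ → f ⊛ g ≋ f′ ⊛ g′
  ⊛-cong p q zero    = *-cong (p 0) (q 0)
  ⊛-cong p q (suc n) = +-cong (*-cong (p 0) (q (suc n))) (⊛-cong (p ∘ suc) q n)

  ⊛-zeroˡ : ∀ {f} g → f ≋ (λ _ → 0#) → f ⊛ g ≋ (λ _ → 0#)
  ⊛-zeroˡ g p zero    = trans (*-congʳ (p 0)) (zeroˡ _)
  ⊛-zeroˡ g p (suc n) = trans
    (+-cong (trans (*-congʳ (p 0)) (zeroˡ _)) (⊛-zeroˡ g (p ∘ suc) n)) (+-identityˡ 0#)

  const-cong : ∀ {k l} → k ≈ l → const k ≋ const l
  const-cong k≈l zero    = k≈l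
  const-cong k≈l (suc n) = refl

  const-0 : const 0# ≋ λ _ → 0#
  const-0 zero    = refl
  const-0 (suc n) = refl

  const-+ : ∀ k l → const (k + l) ≋ λ n → const k n + const l n
  const-+ k l zero    = refl
  const-+ k l (suc n) = sym (+-identityʳ 0#)

  const-⊛ : ∀ k g → const k ⊛ g ≋ λ n → k * g n
  const-⊛ k g zero    = refl
  const-⊛ k g (suc n) = trans (+-congˡ (⊛-zeroˡ g (λ _ → refl) n)) (+-identityʳ _)

  X-⊛-zero : ∀ g → (X ⊛ g) 0 ≈ 0#
  X-⊛-zero g = zeroˡ _

  X-⊛-suc : ∀ g n → (X ⊛ g) (suc n) ≈ g n
  X-⊛-suc g n = begin
    0# * g (suc n) + (const 1# ⊛ g) n ≈⟨ +-cong (zeroˡ _) (const-⊛ 1# g n) ⟩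
    0# + 1# * g n                     ≈⟨ +-identityˡ _ ⟩
    1# * g n                          ≈⟨ *-identityˡ _ ⟩
    g n                               ∎

  ⊛-distribʳ : ∀ h f g → (λ n → f n + g n) ⊛ h ≋ λ n → (f ⊛ h) n + (g ⊛ h) n
  ⊛-distribʳ h f g zero    = distribʳ _ _ _
  ⊛-distribʳ h f g (suc n) =
    trans (+-cong (distribʳ _ _ _) (⊛-distribʳ h (f ∘ suc) (g ∘ suc) n)) (interchange _ _ _ _)

  -- The definition peels only the left factor. Commutativity at smaller indices lets the right
  -- factor be peeled as well, down to the product of the two tails, where f and g can change
  -- places.
  ⊛-comm : ∀ f g → f ⊛ g ≋ g ⊛ f
  ⊛-comm f g zero          = *-comm _ _
  ⊛-comm f g (suc zero)    = trans (+-comm _ _) (+-cong (*-comm _ _) (*-comm _ _))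
  ⊛-comm f g (suc (suc n)) = begin
    f 0 * g (2 ℕ.+ n) + (f ∘ suc ⊛ g) (suc n)
      ≈⟨ +-congˡ (⊛-comm (f ∘ suc) g (suc n)) ⟩
    f 0 * g (2 ℕ.+ n) + (g 0 * f (2 ℕ.+ n) + (g ∘ suc ⊛ f ∘ suc) n)
      ≈⟨ x∙yz≈y∙xz _ _ _ ⟩
    g 0 * f (2 ℕ.+ n) + (f 0 * g (2 ℕ.+ n) + (g ∘ suc ⊛ f ∘ suc) n)
      ≈⟨ +-congˡ (+-congˡ (⊛-comm (g ∘ suc) (f ∘ suc) n)) ⟩
    g 0 * f (2 ℕ.+ n) + (f ⊛ g ∘ suc) (suc n)
      ≈⟨ +-congˡ (⊛-comm f (g ∘ suc) (suc n)) ⟩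
    g 0 * f (2 ℕ.+ n) + (g ∘ suc ⊛ f) (suc n) ∎

  scale-⊛ : ∀ k f g → (λ n → k * f n) ⊛ g ≋ λ n → k * (f ⊛ g) n
  scale-⊛ k f g zero    = *-assoc _ _ _
  scale-⊛ k f g (suc n) =
    trans (+-cong (*-assoc _ _ _) (scale-⊛ k (f ∘ suc) g n)) (sym (distribˡ _ _ _))

  ⊛-assoc : ∀ f g h → (f ⊛ g) ⊛ h ≋ f ⊛ (g ⊛ h)
  ⊛-assoc f g h zero    = *-assoc _ _ _
  ⊛-assoc f g h (suc n) = begin
    (f 0 * g 0) * h (suc n) + ((λ m → f 0 * g (suc m) + (f ∘ suc ⊛ g) m) ⊛ h) n
      ≈⟨ +-cong (*-assoc _ _ _) (⊛-distribʳ h _ (f ∘ suc ⊛ g) n) ⟩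
    f 0 * (g 0 * h (suc n)) + (((λ m → f 0 * g (suc m)) ⊛ h) n + (f ∘ suc ⊛ g ⊛ h) n)
      ≈⟨ +-congˡ (+-cong (scale-⊛ (f 0) (g ∘ suc) h n) (⊛-assoc (f ∘ suc) g h n)) ⟩
    f 0 * (g 0 * h (suc n)) + (f 0 * (g ∘ suc ⊛ h) n + (f ∘ suc ⊛ (g ⊛ h)) n)
      ≈⟨ +-assoc _ _ _ ⟨
    f 0 * (g 0 * h (suc n)) + f 0 * (g ∘ suc ⊛ h) n + (f ∘ suc ⊛ (g ⊛ h)) n
      ≈⟨ +-congʳ (distribˡ _ _ _) ⟨
    f 0 * (g 0 * h (suc n) + (g ∘ suc ⊛ h) n) + (f ∘ suc ⊛ (g ⊛ h)) n ∎

  ⊛-identityˡ : ∀ f → const 1# ⊛ f ≋ f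
  ⊛-identityˡ f n = trans (const-⊛ 1# f n) (*-identityˡ _)

  powerSeries : CommutativeRing c ℓ
  powerSeries = record
    { Carrier = Series
    ; _≈_ = _≋_
    ; _+_ = λ f g n → f n + g n
    ; _*_ = _⊛_
    ; -_  = λ f n → - f n
    ; 0#  = λ _ → 0#
    ; 1#  = const 1#
    ; isCommutativeRing = record
      { isRing = record
        { +-isAbelianGroup = Pointwise.isAbelianGroup ℕ +-isAbelianGroup
        ; *-cong = ⊛-cong
        ; *-assoc = ⊛-assoc
        ; *-identity = ⊛-identityˡ , λ f n → trans (⊛-comm f _ n) (⊛-identityˡ f n)
        ; distrib = (λ h f g n → trans (⊛-comm h _ n)
                       (trans (⊛-distribʳ h f g n) (+-cong (⊛-comm f h n) (⊛-comm g h n))))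
                  , ⊛-distribʳ
        }
      ; *-comm = ⊛-comm
      }
    }

  open import Algebra.Properties.Ring ring using (-0#≈0#)
  open import Algebra.Properties.Monoid.Sum +-monoid using (sum; sum-cong-≋)
  open import Algebra.Properties.Semiring.Exp (CommutativeRing.semiring powerSeries) using (_^_)
  module S = CommutativeRing powerSeries

  HasDegree : ℕ → Series → Set ℓ
  HasDegree k f = ∀ n → k ℕ.< n → f n ≈ 0#

  ⊛-degree : ∀ {k l f g} → HasDegree k f → HasDegree l g → HasDegree (k ℕ.+ l) (f ⊛ g)
  ⊛-degree {k} {l} {f} {g} df dg (suc n) k+l<n =
    trans (+-cong (trans (*-congˡ (dg (suc n) (ℕ.≤-<-trans (ℕ.m≤n+m l k) k+l<n))) (zeroʳ _))
                  (shifted k df k+l<n))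
          (+-identityʳ 0#)
    where
    -- Dropping the first coefficient lowers the degree by one; from degree 0 it leaves the zero
    -- series.
    shifted : ∀ k → HasDegree k f → k ℕ.+ l ℕ.< suc n → (f ∘ suc ⊛ g) n ≈ 0#
    shifted zero    df _           = ⊛-zeroˡ g (λ m → df (suc m) (s≤s z≤n)) n
    shifted (suc k) df (s≤s k+l<n) =
      ⊛-degree {k} {l} (λ m k<m → df (suc m) (s≤s k<m)) dg n k+l<n

  degree : Filtration powerSeries ℓ
  degree = record
    { Deg     = HasDegree
    ; 0-deg   = λ _ _ → refl
    ; 1-deg   = λ { (suc n) _ → refl }
    ; +-deg   = λ df dg n k<n → trans (+-cong (df n k<n) (dg n k<n)) (+-identityʳ 0#)
    ; neg-deg = λ df n k<n → trans (-‿cong (df n k<n)) -0#≈0#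
    ; *-deg   = ⊛-degree
    }

  X-degree : HasDegree 1 X
  X-degree (suc (suc n)) _ = refl
  X-degree (suc zero) (s≤s ())

  const-degree : ∀ {k a} → HasDegree k (const a)
  const-degree (suc n) _ = refl

  module _ {r} (Φ : Filtration K r) where
    open Filtration Φ

    ⊛-coefficients : ∀ {k l f g} → (∀ n → Deg k (f n)) → (∀ n → Deg l (g n)) →
                     ∀ n → Deg (k ℕ.+ l) ((f ⊛ g) n)
    ⊛-coefficients df dg zero    = *-deg (df 0) (dg 0)
    ⊛-coefficients df dg (suc n) =
      +-deg (*-deg (df 0) (dg (suc n))) (⊛-coefficients (df ∘ suc) dg n)

    const-coefficients : ∀ {k a} → Deg k a → ∀ n → Deg k (const a n)
    const-coefficients d zero    = d
    const-coefficients d (suc n) = 0-deg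

    X-coefficients : ∀ {k} n → Deg k (X n)
    X-coefficients zero    = 0-deg
    X-coefficients (suc n) = const-coefficients 1-deg n

    -- Supplies the degree in the inner variable when series are iterated; `degree` measures the
    -- outer one.
    coefficients : Filtration powerSeries r
    coefficients = record
      { Deg     = λ k f → ∀ n → Deg k (f n)
      ; 0-deg   = λ _ → 0-deg
      ; 1-deg   = const-coefficients 1-deg
      ; +-deg   = λ df dg n → +-deg (df n) (dg n)
      ; neg-deg = λ df n → neg-deg (df n)
      ; *-deg   = ⊛-coefficients
      }

  ⊛-split : ∀ f g n → (f ⊛ g) n ≈ f 0 * g n + (X ⊛ (f ∘ suc ⊛ g)) n
  ⊛-split f g zero    = sym (trans (+-congˡ (X-⊛-zero (f ∘ suc ⊛ g))) (+-identityʳ _))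
  ⊛-split f g (suc n) = +-congˡ (sym (X-⊛-suc (f ∘ suc ⊛ g) n))

  -- Horner's scheme: each step splits off the constant term of f and hands the remaining factor X
  -- over to g, so the powers of X accumulate there.
  expand : ∀ d f g → (∀ n → d ℕ.≤ n → f n ≈ 0#) → ∀ n →
           (f ⊛ g) n ≈ sum {d} (λ i → f (toℕ i) * (X ^ toℕ i ⊛ g) n)
  expand zero    f g df n = ⊛-zeroˡ g (λ m → df m z≤n) n
  expand (suc d) f g df n = begin
    (f ⊛ g) n
      ≈⟨ ⊛-split f g n ⟩
    f 0 * g n + (X ⊛ (f ∘ suc ⊛ g)) n
      ≈⟨ +-cong (*-congˡ (sym (⊛-identityˡ g n))) (⊛.x∙yz≈y∙xz X (f ∘ suc) g n) ⟩
    f 0 * (const 1# ⊛ g) n + (f ∘ suc ⊛ (X ⊛ g)) n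
      ≈⟨ +-congˡ (expand d (f ∘ suc) (X ⊛ g) (λ m d≤m → df (suc m) (s≤s d≤m)) n) ⟩
    f 0 * (const 1# ⊛ g) n + sum {d} (λ i → f (suc (toℕ i)) * (X ^ toℕ i ⊛ (X ⊛ g)) n)
      ≈⟨ +-congˡ (sum-cong-≋ {d} λ i → *-congˡ
           (S.trans (⊛.x∙yz≈y∙xz (X ^ toℕ i) X g) (S.sym (S.*-assoc X (X ^ toℕ i) g)) n)) ⟩
    f 0 * (const 1# ⊛ g) n + sum {d} (λ i → f (suc (toℕ i)) * (X ^ suc (toℕ i) ⊛ g) n) ∎
    where module ⊛ = CommutativeSemigroupProperties S.*-commutativeSemigroup

  X^-⊛-+ : ∀ k g n → (X ^ k ⊛ g) (k ℕ.+ n) ≈ g n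
  X^-⊛-+ zero    g n = ⊛-identityˡ g n
  X^-⊛-+ (suc k) g n = trans (⊛-assoc X (X ^ k) g (suc (k ℕ.+ n)))
    (trans (X-⊛-suc (X ^ k ⊛ g) (k ℕ.+ n)) (X^-⊛-+ k g n))

  X^-⊛-< : ∀ k g {n} → n ℕ.< k → (X ^ k ⊛ g) n ≈ 0#
  X^-⊛-< (suc k) g {zero}  _         = trans (⊛-assoc X (X ^ k) g 0) (X-⊛-zero (X ^ k ⊛ g))
  X^-⊛-< (suc k) g {suc n} (s≤s n<k) = trans (⊛-assoc X (X ^ k) g (suc n))
    (trans (X-⊛-suc (X ^ k ⊛ g) n) (X^-⊛-< k g n<k))

  -- A shift by p keeps the residue i and lowers m by one. The bound on i matters at m = 0, where
  -- the index i lies below the lowest term of X^p g.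
  X^-⊛-section : ∀ p {i} → i ℕ.< p → ∀ g m →
                 (X ^ p ⊛ g) (p ℕ.* m ℕ.+ i) ≈ (X ⊛ λ m → g (p ℕ.* m ℕ.+ i)) m
  X^-⊛-section p {i} i<p g zero = trans
    (X^-⊛-< p g (≡.subst (ℕ._< p) (≡.sym (≡.cong (ℕ._+ i) (ℕ.*-zeroʳ p))) i<p))
    (sym (X-⊛-zero (λ m → g (p ℕ.* m ℕ.+ i))))
  X^-⊛-section p {i} i<p g (suc m) = begin
    (X ^ p ⊛ g) (p ℕ.* suc m ℕ.+ i)
      ≡⟨ ≡.cong (X ^ p ⊛ g) (≡.trans (≡.cong (ℕ._+ i) (ℕ.*-suc p m)) (ℕ.+-assoc p (p ℕ.* m) i)) ⟩
    (X ^ p ⊛ g) (p ℕ.+ (p ℕ.* m ℕ.+ i))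
      ≈⟨ X^-⊛-+ p g (p ℕ.* m ℕ.+ i) ⟩
    g (p ℕ.* m ℕ.+ i)
      ≈⟨ X-⊛-suc (λ m → g (p ℕ.* m ℕ.+ i)) m ⟨
    (X ⊛ λ m → g (p ℕ.* m ℕ.+ i)) (suc m) ∎

  module Inverse (f : Series) (u : Carrier) (f₀u≈1 : f 0 * u ≈ 1#) where

    -- The recursion for the coefficients of 1/f is not structural. Iterated k times from 0, it is,
    -- and the coefficients below k are then the final ones.
    approximation : ℕ → Series
    approximation zero    _       = 0#
    approximation (suc k) zero    = u
    approximation (suc k) (suc n) = - u * (f ∘ suc ⊛ approximation k) n

    inverse : Series
    inverse n = approximation (suc n) n

    -- Makes the iteration stabilise: a coefficient of the product sees no later coefficient of the
    -- right factor.
    ⊛-local : ∀ h {g g′} n → (∀ i → i ℕ.≤ n → g i ≈ g′ i) → (h ⊛ g) n ≈ (h ⊛ g′) n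
    ⊛-local h zero    p = *-congˡ (p 0 z≤n)
    ⊛-local h (suc n) p = +-cong (*-congˡ (p (suc n) ℕ.≤-refl))
      (⊛-local (h ∘ suc) n (λ i i≤n → p i (ℕ.m≤n⇒m≤1+n i≤n)))

    stable : ∀ k l {n} → n ℕ.< k → n ℕ.< l → approximation k n ≈ approximation l n
    stable (suc k) (suc l) {zero}  _         _         = refl
    stable (suc k) (suc l) {suc n} (s≤s n<k) (s≤s n<l) = *-congˡ (⊛-local (f ∘ suc) n
      (λ i i≤n → stable k l (ℕ.≤-<-trans i≤n n<k) (ℕ.≤-<-trans i≤n n<l)))

    ⊛-inverse : f ⊛ inverse ≋ const 1#
    ⊛-inverse zero    = f₀u≈1
    ⊛-inverse (suc n) = begin
      f 0 * (- u * (f ∘ suc ⊛ approximation (suc n)) n) + (f ∘ suc ⊛ inverse) n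
        -- Up to index n, `approximation (suc n)` already has its final values and may be replaced
        -- by `inverse`.
        ≈⟨ +-congʳ (*-congˡ (*-congˡ (⊛-local (f ∘ suc) n
             (λ i i≤n → stable (suc n) (suc i) (s≤s i≤n) ℕ.≤-refl)))) ⟩
      f 0 * (- u * w) + w  ≈⟨ +-congʳ (*-congˡ (-‿distribˡ-* u w)) ⟨
      f 0 * (- (u * w)) + w ≈⟨ +-congʳ (-‿distribʳ-* (f 0) (u * w)) ⟨
      - (f 0 * (u * w)) + w ≈⟨ +-congʳ (-‿cong (*-assoc (f 0) u w)) ⟨
      - (f 0 * u * w) + w   ≈⟨ +-congʳ (-‿cong (trans (*-congʳ f₀u≈1) (*-identityˡ w))) ⟩
      - w + w               ≈⟨ -‿inverseˡ w ⟩
      0#                    ∎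
      where
      open import Algebra.Properties.Ring ring using (-‿distribˡ-*; -‿distribʳ-*)
      w = (f ∘ suc ⊛ inverse) n

-- Determinants by exterior algebra

module Exterior {c ℓ} (R : CommutativeRing c ℓ) where
  open CommutativeRing R hiding (zero)
  open import Algebra.Properties.Ring ring
  open import Algebra.Properties.Semiring.Sum semiring
    using (sum; sum-cong-≋; sum-replicate-zero; ∑-comm; *-distribˡ-sum; *-distribʳ-sum)
  open CommutativeSemigroupProperties +-commutativeSemigroup using (interchange)
  module *-Props = CommutativeSemigroupProperties *-commutativeSemigroup
  open SetoidReasoning setoid

  unit : ∀ {n} → Fin n → Vector Carrier n
  unit i j = if does (i Fin.≟ j) then 1# else 0#

  -- ω s is the coefficient of ω at the product e_s of the basis vectors in s.
  Form : ℕ → Set c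
  Form n = Subset n → Carrier

  -- Splitting off the first basis vector e, v = v₀ e + v′ and ω = ω₀ + e ∧ ω₁ have the product
  -- v′ ∧ ω₀ + e ∧ (v₀ ω₀ − v′ ∧ ω₁).
  infixr 6 _∧_
  _∧_ : ∀ {n} → Vector Carrier n → Form n → Form n
  (v ∧ ω) []            = 0#
  (v ∧ ω) (outside ∷ s) = (tail v ∧ ω ∘ (outside ∷_)) s
  (v ∧ ω) (inside ∷ s)  = v zero * ω (outside ∷ s) - (tail v ∧ ω ∘ (inside ∷_)) s

  -- The unit 1 of the exterior algebra, that is, the empty product.
  vacuum : ∀ {n} → Form n
  vacuum []            = 1#
  vacuum (outside ∷ s) = vacuum s
  vacuum (inside ∷ s)  = 0#

  ⋀ : ∀ {m n} → Vector (Vector Carrier n) m → Form n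
  ⋀ {zero}  r = vacuum
  ⋀ {suc m} r = r zero ∧ ⋀ (tail r)

  -- The exterior product of the n rows is the determinant times the product of all basis vectors.
  det : ∀ {n} → Vector (Vector Carrier n) n → Carrier
  det r = ⋀ r full

  -- The minor with its sign, kept at full size by a unit vector in place of row i, so that neither
  -- signs nor deleted rows and columns appear.
  cofactor : ∀ {n} → Vector (Vector Carrier n) n → Fin n → Fin n → Carrier
  cofactor r i k = ⋀ (updateAt r i (λ _ → unit k)) full

  ∧-cong : ∀ {n} (v : Vector Carrier n) {ω η} → (∀ s → ω s ≈ η s) → ∀ s → (v ∧ ω) s ≈ (v ∧ η) s
  ∧-cong v p []            = refl
  ∧-cong v p (outside ∷ s) = ∧-cong (tail v) (λ s → p (outside ∷ s)) s
  ∧-cong v p (inside ∷ s)  = +-cong (*-congˡ (p (outside ∷ s)))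
    (-‿cong (∧-cong (tail v) (λ s → p (inside ∷ s)) s))

  ∧-congˡ : ∀ {n} {v w : Vector Carrier n} ω → (∀ i → v i ≈ w i) → ∀ s → (v ∧ ω) s ≈ (w ∧ ω) s
  ∧-congˡ ω p []            = refl
  ∧-congˡ ω p (outside ∷ s) = ∧-congˡ _ (p ∘ suc) s
  ∧-congˡ ω p (inside ∷ s)  = +-cong (*-congʳ (p zero)) (-‿cong (∧-congˡ _ (p ∘ suc) s))

  ⋀-cong : ∀ {m n} {r r′ : Vector (Vector Carrier n) m} → (∀ i j → r i j ≈ r′ i j) →
           ∀ s → ⋀ r s ≈ ⋀ r′ s
  ⋀-cong {zero}          p s = refl
  ⋀-cong {suc m} {r = r} p s = trans (∧-congˡ _ (p zero) s) (∧-cong _ (⋀-cong (p ∘ suc)) s)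

  x*0-0≈0 : ∀ {x y z} → y ≈ 0# → z ≈ 0# → x * y - z ≈ 0#
  x*0-0≈0 y≈0 z≈0 = trans
    (+-cong (trans (*-congˡ y≈0) (zeroʳ _)) (trans (-‿cong z≈0) -0#≈0#)) (+-identityʳ 0#)

  ∧-zeroʳ : ∀ {n} (v : Vector Carrier n) {ω} → (∀ s → ω s ≈ 0#) → ∀ s → (v ∧ ω) s ≈ 0#
  ∧-zeroʳ v p []            = refl
  ∧-zeroʳ v p (outside ∷ s) = ∧-zeroʳ (tail v) (λ s → p (outside ∷ s)) s
  ∧-zeroʳ v p (inside ∷ s)  =
    x*0-0≈0 (p (outside ∷ s)) (∧-zeroʳ (tail v) (λ s → p (inside ∷ s)) s)

  ∧-zeroˡ : ∀ {n} (ω : Form n) s → ((λ _ → 0#) ∧ ω) s ≈ 0#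
  ∧-zeroˡ ω []            = refl
  ∧-zeroˡ ω (outside ∷ s) = ∧-zeroˡ (ω ∘ (outside ∷_)) s
  ∧-zeroˡ ω (inside ∷ s)  =
    trans (+-cong (zeroˡ _) (-‿cong (∧-zeroˡ (ω ∘ (inside ∷_)) s))) (-‿inverseʳ 0#)

  ∧-linearʳ : ∀ {n} (v : Vector Carrier n) a ω η s →
              (v ∧ λ s → a * ω s + η s) s ≈ a * (v ∧ ω) s + (v ∧ η) s
  ∧-linearʳ v a ω η []            = sym (trans (+-congʳ (zeroʳ a)) (+-identityʳ 0#))
  ∧-linearʳ v a ω η (outside ∷ s) = ∧-linearʳ (tail v) a _ _ s
  ∧-linearʳ v a ω η (inside ∷ s)  = begin
    x * (a * y + z) - (tail v ∧ λ s → a * ω (inside ∷ s) + η (inside ∷ s)) s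
      ≈⟨ +-cong (distribˡ x _ z) (-‿cong (∧-linearʳ (tail v) a _ _ s)) ⟩
    x * (a * y) + x * z - (a * u + w)
      ≈⟨ +-cong (+-congʳ (*-Props.x∙yz≈y∙xz x a y)) (sym (-‿+-comm (a * u) w)) ⟩
    a * (x * y) + x * z + (- (a * u) - w)
      ≈⟨ interchange _ _ _ _ ⟩
    a * (x * y) - a * u + (x * z - w)
      ≈⟨ +-congʳ (trans (+-congˡ (-‿distribʳ-* a u)) (sym (distribˡ a _ _))) ⟩
    a * (x * y - u) + (x * z - w) ∎
    where
    x = v zero
    y = ω (outside ∷ s)
    z = η (outside ∷ s)
    u = (tail v ∧ ω ∘ (inside ∷_)) s
    w = (tail v ∧ η ∘ (inside ∷_)) s

  ∧-neg : ∀ {n} (v : Vector Carrier n) ω s → (v ∧ λ s → - ω s) s ≈ - (v ∧ ω) s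
  ∧-neg v ω []            = sym -0#≈0#
  ∧-neg v ω (outside ∷ s) = ∧-neg (tail v) _ s
  ∧-neg v ω (inside ∷ s)  = trans
    (+-cong (sym (-‿distribʳ-* _ _)) (-‿cong (∧-neg (tail v) (ω ∘ (inside ∷_)) s)))
    (-‿+-comm _ _)

  ∧-sum : ∀ {n} (v : Vector Carrier n) m (a : Vector Carrier m) (ω : Fin m → Form n) s →
          (v ∧ λ s → sum (λ k → a k * ω k s)) s ≈ sum (λ k → a k * (v ∧ ω k) s)
  ∧-sum v zero    a ω s = ∧-zeroʳ v (λ _ → refl) s
  ∧-sum v (suc m) a ω s = trans (∧-linearʳ v (a zero) (ω zero) _ s)
    (+-congˡ (∧-sum v m (tail a) (tail ω) s))

  -- With v = v₀e + v′ and w = w₀e + w′ the term in e ∧ e is gone. What remains is visibly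
  -- antisymmetric except for v′ ∧ w′ ∧ ω₁, which lives in one dimension less and falls to
  -- induction.
  ∧-∧-inside : ∀ {n} (v w : Vector Carrier (suc n)) ω s →
               (v ∧ w ∧ ω) (inside ∷ s) ≈
               (v zero * (tail w ∧ ω ∘ (outside ∷_)) s - w zero * (tail v ∧ ω ∘ (outside ∷_)) s)
               + (tail v ∧ tail w ∧ ω ∘ (inside ∷_)) s
  ∧-∧-inside v w ω s = begin
    A - (tail v ∧ λ s → w zero * ω (outside ∷ s) - (tail w ∧ ω ∘ (inside ∷_)) s) s
      ≈⟨ +-congˡ (-‿cong (∧-linearʳ (tail v) (w zero) (ω ∘ (outside ∷_))
           (λ s → - (tail w ∧ ω ∘ (inside ∷_)) s) s)) ⟩
    A - (B + (tail v ∧ λ s → - (tail w ∧ ω ∘ (inside ∷_)) s) s)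
      ≈⟨ +-congˡ (-‿cong (+-congˡ (∧-neg (tail v) (tail w ∧ ω ∘ (inside ∷_)) s))) ⟩
    A - (B - C)      ≈⟨ +-congˡ (-‿+-comm B (- C)) ⟨
    A + (- B - - C)  ≈⟨ +-congˡ (+-congˡ (-‿involutive C)) ⟩
    A + (- B + C)    ≈⟨ +-assoc A (- B) C ⟨
    A - B + C        ∎
    where
    A = v zero * (tail w ∧ ω ∘ (outside ∷_)) s
    B = w zero * (tail v ∧ ω ∘ (outside ∷_)) s
    C = (tail v ∧ tail w ∧ ω ∘ (inside ∷_)) s

  ∧-anticomm : ∀ {n} (v w : Vector Carrier n) ω s → (v ∧ w ∧ ω) s ≈ - (w ∧ v ∧ ω) s
  ∧-anticomm v w ω []            = sym -0#≈0#
  ∧-anticomm v w ω (outside ∷ s) = ∧-anticomm (tail v) (tail w) _ s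
  ∧-anticomm v w ω (inside ∷ s)  = begin
    (v ∧ w ∧ ω) (inside ∷ s)  ≈⟨ ∧-∧-inside v w ω s ⟩
    A - B + (tail v ∧ tail w ∧ ω ∘ (inside ∷_)) s
      ≈⟨ +-cong (sym A-B) (∧-anticomm (tail v) (tail w) _ s) ⟩
    - (B - A) - C             ≈⟨ -‿+-comm (B - A) C ⟩
    - (B - A + C)             ≈⟨ -‿cong (∧-∧-inside w v ω s) ⟨
    - (w ∧ v ∧ ω) (inside ∷ s) ∎
    where
    A = v zero * (tail w ∧ ω ∘ (outside ∷_)) s
    B = w zero * (tail v ∧ ω ∘ (outside ∷_)) s
    C = (tail w ∧ tail v ∧ ω ∘ (inside ∷_)) s
    A-B : - (B - A) ≈ A - B
    A-B = trans (sym (-‿+-comm B (- A))) (trans (+-congˡ (-‿involutive A)) (+-comm (- B) A))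

  -- Not a consequence of `∧-anticomm`, which gives only that twice the product vanishes and so says
  -- nothing for p = 2.
  ∧-self : ∀ {n} (v : Vector Carrier n) ω s → (v ∧ v ∧ ω) s ≈ 0#
  ∧-self v ω []            = refl
  ∧-self v ω (outside ∷ s) = ∧-self (tail v) _ s
  ∧-self v ω (inside ∷ s)  = trans (∧-∧-inside v v ω s)
    (trans (+-cong (-‿inverseʳ _) (∧-self (tail v) (ω ∘ (inside ∷_)) s)) (+-identityʳ 0#))

  ∧-basis : ∀ {n} (v : Vector Carrier n) ω s → (v ∧ ω) s ≈ sum (λ k → v k * (unit k ∧ ω) s)
  ∧-basis v ω []            = refl
  ∧-basis v ω (outside ∷ s) = begin
    (tail v ∧ ω ∘ (outside ∷_)) s
      ≈⟨ ∧-basis (tail v) _ s ⟩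
    sum (λ k → v (suc k) * (unit k ∧ ω ∘ (outside ∷_)) s)
      ≈⟨ +-identityˡ _ ⟨
    0# + sum (λ k → v (suc k) * (unit k ∧ ω ∘ (outside ∷_)) s)
      ≈⟨ +-congʳ (trans (*-congˡ (∧-zeroˡ _ s)) (zeroʳ (v zero))) ⟨
    sum (λ k → v k * (unit k ∧ ω) (outside ∷ s)) ∎
  ∧-basis {suc n} v ω (inside ∷ s) = begin
    v zero * x - (tail v ∧ ω ∘ (inside ∷_)) s
      ≈⟨ +-cong (*-congˡ (sym first)) (-‿cong (∧-basis (tail v) _ s)) ⟩
    v zero * (unit zero ∧ ω) (inside ∷ s) - sum {n} (λ k → v (suc k) * y k)
      -- As a factor -1, the sign enters the sum by distributivity.
      ≈⟨ +-congˡ (sym (-1*x≈-x _)) ⟩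
    v zero * (unit zero ∧ ω) (inside ∷ s) + - 1# * sum {n} (λ k → v (suc k) * y k)
      ≈⟨ +-congˡ (*-distribˡ-sum {n} (- 1#) (λ k → v (suc k) * y k)) ⟩
    v zero * (unit zero ∧ ω) (inside ∷ s) + sum {n} (λ k → - 1# * (v (suc k) * y k))
      ≈⟨ +-congˡ (sum-cong-≋ {n} λ k → trans (*-Props.x∙yz≈y∙xz (- 1#) (v (suc k)) (y k))
           (*-congˡ (trans (-1*x≈-x (y k)) (sym (trans (+-congʳ (zeroˡ x)) (+-identityˡ _)))))) ⟩
    sum {suc n} (λ k → v k * (unit k ∧ ω) (inside ∷ s)) ∎
    where
    x = ω (outside ∷ s)
    y : Fin n → Carrier
    y k = (unit k ∧ ω ∘ (inside ∷_)) s
    first : (unit zero ∧ ω) (inside ∷ s) ≈ x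
    first = trans
      (+-cong (*-identityˡ x) (trans (-‿cong (∧-zeroˡ (ω ∘ (inside ∷_)) s)) -0#≈0#)) (+-identityʳ x)

  -- Multilinearity in row i; at the full subset this is expansion along that row.
  ⋀-basis : ∀ {m n} (r : Vector (Vector Carrier n) m) i v s →
            ⋀ (updateAt r i (λ _ → v)) s ≈ sum (λ k → v k * ⋀ (updateAt r i (λ _ → unit k)) s)
  ⋀-basis {suc m}     r zero    v s = ∧-basis v (⋀ (tail r)) s
  ⋀-basis {suc m} {n} r (suc i) v s = trans (∧-cong (r zero) (⋀-basis (tail r) i v) s)
    (∧-sum (r zero) n v (λ k → ⋀ (updateAt (tail r) i (λ _ → unit k))) s)

  -- Anticommutativity carries v past the earlier rows until it stands next to its copy.
  ∧-⋀-repeated : ∀ {m n} (r : Vector (Vector Carrier n) m) i v s →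
                 (v ∧ ⋀ (updateAt r i (λ _ → v))) s ≈ 0#
  ∧-⋀-repeated {suc m} r zero    v s = ∧-self v (⋀ (tail r)) s
  ∧-⋀-repeated {suc m} r (suc i) v s = trans (∧-anticomm v (r zero) _ s)
    (trans (-‿cong (∧-zeroʳ (r zero) (∧-⋀-repeated (tail r) i v) s)) -0#≈0#)

  ⋀-update-self : ∀ {m n} (r : Vector (Vector Carrier n) m) i s →
                  ⋀ (updateAt r i (λ _ → r i)) s ≈ ⋀ r s
  ⋀-update-self {suc m} r zero    s = refl
  ⋀-update-self {suc m} r (suc i) s = ∧-cong (r zero) (⋀-update-self (tail r) i) s

  ⋀-repeated : ∀ {m n} (r : Vector (Vector Carrier n) m) i j → i ≢ j → ∀ s →
               ⋀ (updateAt r i (λ _ → r j)) s ≈ 0#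
  ⋀-repeated {suc m} r zero    zero    i≢j s = contradiction ≡.refl i≢j
  ⋀-repeated {suc m} r zero    (suc j) i≢j s = trans
    -- The tail is rewritten as its own update at j, the shape in which `∧-⋀-repeated` recognises
    -- the second copy.
    (∧-cong (r (suc j)) (λ s → sym (⋀-update-self (tail r) j s)) s)
    (∧-⋀-repeated (tail r) j (r (suc j)) s)
  ⋀-repeated {suc m} r (suc i) zero    i≢j s = ∧-⋀-repeated (tail r) i (r zero) s
  ⋀-repeated {suc m} r (suc i) (suc j) i≢j s =
    ∧-zeroʳ (r zero) (⋀-repeated (tail r) i j (i≢j ∘ ≡.cong suc)) s

  -- The sum is the determinant after row i has been overwritten by row j: nothing changes if i = j,
  -- and otherwise two rows agree.
  cofactor-expansion : ∀ {n} (r : Vector (Vector Carrier n) n) i j →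
                       sum (λ k → r j k * cofactor r i k) ≈ unit i j * det r
  cofactor-expansion r i j with i Fin.≟ j
  ... | yes ≡.refl = trans (sym (⋀-basis r i (r i) full))
                       (trans (⋀-update-self r i full) (sym (*-identityˡ _)))
  ... | no i≢j = trans (sym (⋀-basis r i (r j) full))
                       (trans (⋀-repeated r i j i≢j full) (sym (zeroˡ _)))

  unit-sym : ∀ {n} (i j : Fin n) → unit i j ≡ unit j i
  unit-sym zero    zero    = ≡.refl
  unit-sym zero    (suc j) = ≡.refl
  unit-sym (suc i) zero    = ≡.refl
  unit-sym (suc i) (suc j) = unit-sym i j

  sum-unit : ∀ {n} (i : Fin n) x → sum (λ j → unit i j * x j) ≈ x i
  sum-unit {suc n} zero    x = trans
    (+-cong (*-identityˡ _)
      (trans (sum-cong-≋ {n} (λ j → zeroˡ (x (suc j)))) (sum-replicate-zero n)))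
    (+-identityʳ _)
  sum-unit {suc n} (suc i) x = trans (+-cong (zeroˡ _) (sum-unit i (tail x))) (+-identityˡ _)

  -- adj(L)·L = det(L) and L·F = 1 give det(L)·F = adj(L); the rows of r are the columns of L.
  det-solution : ∀ {n} (r F : Vector (Vector Carrier n) n) →
                 (∀ i j → sum (λ k → r k i * F k j) ≈ unit i j) →
                 ∀ i j → det r * F i j ≈ cofactor r i j
  det-solution {n} r F solves i j = begin
    det r * F i j
      ≈⟨ *-congˡ (sum-unit i (λ l → F l j)) ⟨
    det r * sum (λ l → unit i l * F l j)
      ≈⟨ *-distribˡ-sum {n} (det r) (λ l → unit i l * F l j) ⟩
    sum (λ l → det r * (unit i l * F l j))
      ≈⟨ sum-cong-≋ {n} (λ l → trans (sym (*-assoc _ _ _))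
           (*-congʳ (trans (*-comm _ _) (sym (cofactor-expansion r i l))))) ⟩
    sum (λ l → sum (λ k → r l k * cofactor r i k) * F l j)
      ≈⟨ sum-cong-≋ {n} (λ l → *-distribʳ-sum {n} (F l j) (λ k → r l k * cofactor r i k)) ⟩
    sum (λ l → sum (λ k → r l k * cofactor r i k * F l j))
      ≈⟨ ∑-comm {n} {n} (λ l k → r l k * cofactor r i k * F l j) ⟩
    sum (λ k → sum (λ l → r l k * cofactor r i k * F l j))
      ≈⟨ sum-cong-≋ {n} (λ k → trans
           (sum-cong-≋ {n} (λ l → *-Props.xy∙z≈y∙xz (r l k) (cofactor r i k) (F l j)))
           (sym (*-distribˡ-sum {n} (cofactor r i k) (λ l → r l k * F l j)))) ⟩
    sum (λ k → cofactor r i k * sum (λ l → r l k * F l j))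
      ≈⟨ sum-cong-≋ {n} (λ k → trans
           (*-congˡ (trans (solves k j) (reflexive (unit-sym k j)))) (*-comm _ _)) ⟩
    sum (λ k → unit j k * cofactor r i k)
      ≈⟨ sum-unit j (cofactor r i) ⟩
    cofactor r i j ∎

  ⋀-outside : ∀ {m n} (r : Vector (Vector Carrier (suc n)) m) s →
              ⋀ r (outside ∷ s) ≈ ⋀ (tail ∘ r) s
  ⋀-outside {zero}  r s = refl
  ⋀-outside {suc m} r s = ∧-cong (tail (r zero)) (⋀-outside (tail r)) s

  -- The first row is e, and the top coefficient of e ∧ ω is that of ω at the subset without e.
  -- There only the truncated rows count, and they form a smaller identity matrix.
  det-unit : ∀ n → det (unit {n}) ≈ 1#
  det-unit zero    = refl
  det-unit (suc n) = begin
    1# * ⋀ {n} (tail unit) (outside ∷ full) - ((λ _ → 0#) ∧ ⋀ {n} (tail unit) ∘ (inside ∷_)) full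
      ≈⟨ +-cong (*-identityˡ _) (-‿cong (∧-zeroˡ _ (full {n}))) ⟩
    ⋀ {n} (tail unit) (outside ∷ full) - 0#
      ≈⟨ trans (+-congˡ -0#≈0#) (+-identityʳ _) ⟩
    ⋀ {n} (tail unit) (outside ∷ full)
      ≈⟨ ⋀-outside {n} (tail unit) full ⟩
    det (unit {n})
      ≈⟨ det-unit n ⟩
    1# ∎

  module _ {r} (Φ : Filtration R r) where
    open Filtration Φ

    ∧-deg : ∀ {n k l} {v : Vector Carrier n} {ω} → (∀ i → Deg k (v i)) → (∀ s → Deg l (ω s)) →
            ∀ s → Deg (k ℕ.+ l) ((v ∧ ω) s)
    ∧-deg dv dω []            = 0-deg
    ∧-deg dv dω (outside ∷ s) = ∧-deg (dv ∘ suc) (dω ∘ (outside ∷_)) s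
    ∧-deg dv dω (inside ∷ s)  = +-deg (*-deg (dv zero) (dω (outside ∷ s)))
      (neg-deg (∧-deg (dv ∘ suc) (dω ∘ (inside ∷_)) s))

    vacuum-deg : ∀ {n} (s : Subset n) → Deg 0 (vacuum s)
    vacuum-deg []            = 1-deg
    vacuum-deg (outside ∷ s) = vacuum-deg s
    vacuum-deg (inside ∷ s)  = 0-deg

    unit-deg : ∀ {n k} (i j : Fin n) → Deg k (unit i j)
    unit-deg i j with does (i Fin.≟ j)
    ... | true  = 1-deg
    ... | false = 0-deg

    -- One degree per factor of the exterior product, with no sum over permutations. It bounds Q in
    -- x and in y, and also shows that Q is Frobenius-linear.
    ⋀-deg : ∀ {m n} {r : Vector (Vector Carrier n) m} → (∀ i j → Deg 1 (r i j)) →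
            ∀ s → Deg m (⋀ r s)
    ⋀-deg {zero}  dr = vacuum-deg
    ⋀-deg {suc m} dr = ∧-deg (dr zero) (⋀-deg (dr ∘ suc))

    -- The constant row saves one degree; this keeps the adjugate within the span of the chosen
    -- monomials.
    ⋀-update-deg : ∀ {m n} {r : Vector (Vector Carrier n) (suc m)} {v} i →
                   (∀ i j → Deg 1 (r i j)) → (∀ j → Deg 0 (v j)) →
                   ∀ s → Deg m (⋀ (updateAt r i (λ _ → v)) s)
    ⋀-update-deg         zero    dr dv = ∧-deg dv (⋀-deg (dr ∘ suc))
    ⋀-update-deg {suc m} (suc i) dr dv = ∧-deg (dr zero) (⋀-update-deg i (dr ∘ suc) dv)

-- Constant terms of determinants of power series

module _ {c ℓ} (K : CommutativeRing c ℓ) where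
  open CommutativeRing K hiding (zero)
  open PowerSeries K
  private
    module EK = Exterior K
    module ES = Exterior powerSeries

  ∧-constant : ∀ {n} v ω (s : Subset n) → ES._∧_ v ω s 0 ≡ EK._∧_ (λ i → v i 0) (λ s → ω s 0) s
  ∧-constant v ω []            = ≡.refl
  ∧-constant v ω (outside ∷ s) = ∧-constant (tail v) (ω ∘ (outside ∷_)) s
  ∧-constant v ω (inside ∷ s)  =
    ≡.cong (λ x → v zero 0 * ω (outside ∷ s) 0 - x) (∧-constant (tail v) (ω ∘ (inside ∷_)) s)

  vacuum-constant : ∀ {n} (s : Subset n) → ES.vacuum s 0 ≡ EK.vacuum s
  vacuum-constant []            = ≡.refl
  vacuum-constant (outside ∷ s) = vacuum-constant s
  vacuum-constant (inside ∷ s)  = ≡.refl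

  -- Taking constant terms is a ring homomorphism. Applied for x and then for y, this evaluates Q at
  -- the origin.
  ⋀-constant : ∀ {m n} (r : Vector (Vector Series n) m) (s : Subset n) →
               ES.⋀ r s 0 ≈ EK.⋀ (λ i j → r i j 0) s
  ⋀-constant {zero}  r s = reflexive (vacuum-constant s)
  ⋀-constant {suc m} r s = trans (reflexive (∧-constant (r zero) _ s))
    (EK.∧-cong _ (⋀-constant (tail r)) s)

-- The prime field

module _ {p : ℕ} (p-prime : Prime p) where

  prime∤! : ∀ k → k ℕ.< p → p ∤ k !
  prime∤! zero    1<p p∣1 = >⇒∤ (ℕ.nonTrivial⇒n>1 p {{prime⇒nonTrivial p-prime}}) p∣1
  prime∤! (suc k) k<p p∣k! =
    [ >⇒∤ k<p , prime∤! k (ℕ.<-trans (ℕ.n<1+n k) k<p) ]′ (euclidsLemma (suc k) (k !) p-prime p∣k!)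

  -- p divides p! = k! (p - k)! C(p, k) but neither factorial, as both are products of numbers below
  -- p.
  prime∣binomial : ∀ k → 0 ℕ.< k → k ℕ.< p → p ∣ p C k
  prime∣binomial k 0<k k<p = [ (λ h → contradiction h denominator) , id ]′
      (euclidsLemma (k ! ℕ.* (p ∸ k) !) (p C k) p-prime (≡.subst (p ∣_) (≡.sym product) p∣p!))
    where
    instance
      _ = k ℕ.!* (p ∸ k) !≢0
    p∣p! : p ∣ p !
    p∣p! = n∣n! p (ℕ.<-trans 0<k k<p)
      where
      n∣n! : ∀ n → 0 ℕ.< n → n ∣ n !
      n∣n! (suc n) _ = m∣m*n (n !)
    product : k ! ℕ.* (p ∸ k) ! ℕ.* (p C k) ≡ p !
    product = ≡.trans (≡.cong (k ! ℕ.* (p ∸ k) ! ℕ.*_) (nCk≡n!/k![n-k]! (ℕ.<⇒≤ k<p)))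
      (m*[n/m]≡n (k![n∸k]!∣n! (ℕ.<⇒≤ k<p)))
    denominator : p ∤ k ! ℕ.* (p ∸ k) !
    denominator h = [ prime∤! k k<p , prime∤! (p ∸ k) (ℕ.∸-monoʳ-< 0<k (ℕ.<⇒≤ k<p)) ]′
      (euclidsLemma (k !) ((p ∸ k) !) p-prime h)

-- Additivity of the p-th power in characteristic p

module Frobenius {c ℓ} (R : CommutativeRing c ℓ) {p : ℕ} (p-prime : Prime p) where
  open CommutativeRing R hiding (zero)
  open import Algebra.Properties.CommutativeSemiring.Binomial commutativeSemiring
    using (theorem; binomialTerm)
  open import Algebra.Properties.CommutativeSemiring.Exp commutativeSemiring using (_^_)
  open import Algebra.Properties.Semiring.Mult semiring
    using (×-assocˡ; ×-congˡ) renaming (_×_ to _×ᴿ_)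
  open import Algebra.Properties.Semiring.Sum semiring
    using (sum; sum-cong-≋; sum-replicate-zero; sum-init-last)
  open SetoidReasoning setoid

  module _ (char : ∀ x → p ×ᴿ x ≈ 0#) where

    multiple≈0 : ∀ {n} → p ∣ n → ∀ x → n ×ᴿ x ≈ 0#
    multiple≈0 (divides-refl q) x = begin
      (q ℕ.* p) ×ᴿ x ≈⟨ ×-congˡ (ℕ.*-comm q p) ⟩
      (p ℕ.* q) ×ᴿ x ≈⟨ ×-assocˡ x p q ⟨
      p ×ᴿ (q ×ᴿ x)  ≈⟨ char (q ×ᴿ x) ⟩
      0#             ∎

    -- The prime is passed as n with an equation so that n can be matched as a successor, which
    -- exposes the first and the last term of the binomial sum.
    binomial≈ends : ∀ n → n ≡ p → ∀ x y → (x + y) ^ n ≈ x ^ n + y ^ n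
    binomial≈ends zero    ≡.refl with () ← prime⇒nonTrivial p-prime
    binomial≈ends (suc n) ≡.refl x y = begin
      (x + y) ^ suc n
        ≈⟨ theorem (suc n) x y ⟩
      t zero + sum {suc n} (t ∘ suc)
        ≈⟨ +-cong first (sum-init-last {n} (t ∘ suc)) ⟩
      y ^ suc n + (sum {n} (λ i → t (suc (inject₁ i))) + t (suc (fromℕ n)))
        ≈⟨ +-congˡ (+-cong (trans (sum-cong-≋ {n} middle) (sum-replicate-zero n)) last) ⟩
      y ^ suc n + (0# + x ^ suc n)
        ≈⟨ trans (+-congˡ (+-identityˡ _)) (+-comm _ _) ⟩
      x ^ suc n + y ^ suc n ∎
      where
      t : Fin (2 ℕ.+ n) → Carrier
      t = binomialTerm x y (suc n)
      first : t zero ≈ y ^ suc n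
      first = trans (+-identityʳ _) (*-identityˡ _)
      middle : ∀ i → t (suc (inject₁ i)) ≈ 0#
      middle i = multiple≈0 (prime∣binomial p-prime _ (s≤s z≤n)
        (s≤s (≡.subst (ℕ._< n) (≡.sym (Fin.toℕ-inject₁ i)) (Fin.toℕ<n i)))) _
      last : t (suc (fromℕ n)) ≈ x ^ suc n
      last rewrite Fin.toℕ-fromℕ n | nCn≡1 (suc n) | ℕ.n∸n≡0 n =
        trans (+-identityʳ _) (*-identityʳ _)

    ^p-distrib-+ : ∀ x y → (x + y) ^ p ≈ x ^ p + y ^ p
    ^p-distrib-+ = binomial≈ends p ≡.refl

-- The ring of residues modulo p

module _ (p : ℕ) .{{_ : NonZero p}} where
  open RawRing (𝔽 p)
  private
    π : ℕ → Fin p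
    π n = n mod p

    toℕ-π : ∀ n → toℕ (π n) ≡ n % p
    toℕ-π n = Fin.toℕ-fromℕ< (m%n<n n p)

    π-cong : ∀ {m n} → m % p ≡ n % p → π m ≡ π n
    π-cong {m} {n} eq = Fin.toℕ-injective (≡.trans (toℕ-π m) (≡.trans eq (≡.sym (toℕ-π n))))

    π-toℕ : ∀ x → π (toℕ x) ≡ x
    π-toℕ x = Fin.toℕ-injective (≡.trans (toℕ-π (toℕ x)) (m<n⇒m%n≡m (Fin.toℕ<n x)))

    %-cong : (_∙_ : ℕ → ℕ → ℕ) → (∀ m n → (m ∙ n) % p ≡ ((m % p) ∙ (n % p)) % p) →
             ∀ m n → π (toℕ (π m) ∙ toℕ (π n)) ≡ π (m ∙ n)
    %-cong _∙_ distrib m n = π-cong (≡.trans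
      (≡.cong₂ (λ a b → (a ∙ b) % p) (toℕ-π m) (toℕ-π n)) (≡.sym (distrib m n)))

    π-+ : ∀ m n → π m + π n ≡ π (m ℕ.+ n)
    π-+ = %-cong ℕ._+_ (λ m n → %-distribˡ-+ m n p)

    π-* : ∀ m n → π m * π n ≡ π (m ℕ.* n)
    π-* = %-cong ℕ._*_ (λ m n → %-distribˡ-* m n p)

    -- Every law of ℕ descends to Fin p, because each element is of the form π m.
    π-elim : ∀ {P : Fin p → Set} → (∀ m → P (π m)) → ∀ x → P x
    π-elim {P} h x = ≡.subst P (π-toℕ x) (h (toℕ x))

    open ≡.≡-Reasoning

    +-assoc : ∀ x y z → (x + y) + z ≡ x + (y + z)
    +-assoc = π-elim λ m → π-elim λ n → π-elim λ o → begin
      (π m + π n) + π o   ≡⟨ ≡.trans (≡.cong (_+ π o) (π-+ m n)) (π-+ (m ℕ.+ n) o) ⟩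
      π (m ℕ.+ n ℕ.+ o)   ≡⟨ ≡.cong π (ℕ.+-assoc m n o) ⟩
      π (m ℕ.+ (n ℕ.+ o)) ≡⟨ ≡.trans (≡.cong (π m +_) (π-+ n o)) (π-+ m (n ℕ.+ o)) ⟨
      π m + (π n + π o)   ∎

    *-assoc : ∀ x y z → (x * y) * z ≡ x * (y * z)
    *-assoc = π-elim λ m → π-elim λ n → π-elim λ o → begin
      (π m * π n) * π o   ≡⟨ ≡.trans (≡.cong (_* π o) (π-* m n)) (π-* (m ℕ.* n) o) ⟩
      π (m ℕ.* n ℕ.* o)   ≡⟨ ≡.cong π (ℕ.*-assoc m n o) ⟩
      π (m ℕ.* (n ℕ.* o)) ≡⟨ ≡.trans (≡.cong (π m *_) (π-* n o)) (π-* m (n ℕ.* o)) ⟨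
      π m * (π n * π o)   ∎

    +-comm : ∀ x y → x + y ≡ y + x
    +-comm x y = ≡.cong π (ℕ.+-comm (toℕ x) (toℕ y))

    *-comm : ∀ x y → x * y ≡ y * x
    *-comm x y = ≡.cong π (ℕ.*-comm (toℕ x) (toℕ y))

    +-identityˡ : ∀ x → 0# + x ≡ x
    +-identityˡ = π-elim (π-+ 0)

    *-identityˡ : ∀ x → 1# * x ≡ x
    *-identityˡ = π-elim λ m → ≡.trans (π-* 1 m) (≡.cong π (ℕ.*-identityˡ m))

    distribʳ : ∀ x y z → (y + z) * x ≡ y * x + z * x
    distribʳ = π-elim λ o → π-elim λ m → π-elim λ n → begin
      (π m + π n) * π o         ≡⟨ ≡.trans (≡.cong (_* π o) (π-+ m n)) (π-* (m ℕ.+ n) o) ⟩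
      π ((m ℕ.+ n) ℕ.* o)       ≡⟨ ≡.cong π (ℕ.*-distribʳ-+ o m n) ⟩
      π (m ℕ.* o ℕ.+ n ℕ.* o)   ≡⟨ π-+ (m ℕ.* o) (n ℕ.* o) ⟨
      π (m ℕ.* o) + π (n ℕ.* o) ≡⟨ ≡.cong₂ _+_ (π-* m o) (π-* n o) ⟨
      π m * π o + π n * π o     ∎

    -‿inverseˡ : ∀ x → - x + x ≡ 0#
    -‿inverseˡ x = begin
      π (p ∸ toℕ x) + x           ≡⟨ ≡.cong (π (p ∸ toℕ x) +_) (π-toℕ x) ⟨
      π (p ∸ toℕ x) + π (toℕ x)   ≡⟨ π-+ (p ∸ toℕ x) (toℕ x) ⟩
      π (p ∸ toℕ x ℕ.+ toℕ x)     ≡⟨ ≡.cong π (ℕ.m∸n+n≡m (ℕ.<⇒≤ (Fin.toℕ<n x))) ⟩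
      π p                         ≡⟨ π-cong (≡.trans (n%n≡0 p) (≡.sym (m*n%n≡0 0 p))) ⟩
      π 0                         ∎

  private
    𝔽-isCommutativeRing : IsCommutativeRing _≡_ _+_ _*_ -_ 0# 1#
    𝔽-isCommutativeRing = record
      { isRing = record
        { +-isAbelianGroup = record
          { isGroup = record
            { isMonoid = record
              { isSemigroup = record
                { isMagma = record { isEquivalence = ≡.isEquivalence ; ∙-cong = ≡.cong₂ _+_ }
                ; assoc   = +-assoc
                }
              ; identity = comm∧idˡ⇒id +-comm +-identityˡ
              }
            ; inverse = comm∧invˡ⇒inv +-comm -‿inverseˡ
            ; ⁻¹-cong = ≡.cong (-_)
            }
          ; comm = +-comm
          }
        ; *-cong     = ≡.cong₂ _*_
        ; *-assoc    = *-assoc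
        ; *-identity = comm∧idˡ⇒id *-comm *-identityˡ
        ; distrib    = comm∧distrʳ⇒distr (≡.cong₂ _+_) *-comm distribʳ
        }
      ; *-comm = *-comm
      }
      where open import Algebra.Consequences.Setoid (≡.setoid (Fin p))

  𝔽-commutativeRing : CommutativeRing 0ℓ 0ℓ
  𝔽-commutativeRing = record { RawRing (𝔽 p) ; isCommutativeRing = 𝔽-isCommutativeRing }

  open import Algebra.Definitions.RawMonoid +-rawMonoid using () renaming (_×_ to _×ᴷ_)
  private
    ×-π : ∀ n → n ×ᴷ 1# ≡ π n
    ×-π zero    = ≡.refl
    ×-π (suc n) = ≡.trans (≡.cong (1# +_) (×-π n)) (π-+ 1 n)

  -- Stands in for Fermat's little theorem: a constant is a sum of ones, so additivity of the p-th
  -- power settles it.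
  𝔽-generated : ∀ x → ∃ λ n → x ≡ n ×ᴷ 1#
  𝔽-generated x = toℕ x , ≡.sym (≡.trans (×-π (toℕ x)) (π-toℕ x))

  𝔽-characteristic : p ×ᴷ 1# ≡ 0#
  𝔽-characteristic = ≡.trans (×-π p) (π-cong (≡.trans (n%n≡0 p) (≡.sym (m*n%n≡0 0 p))))

-- Rational series in two variables

module Bivariate {c ℓ} (K : CommutativeRing c ℓ) where
  module K = CommutativeRing K
  module Y = PowerSeries K
  module X = PowerSeries Y.powerSeries
  open CommutativeRing X.powerSeries public hiding (zero)
  open import Algebra.Properties.CommutativeSemiring.Exp commutativeSemiring public
    using (_^_; ^-congˡ; ^-distrib-*)
  open import Algebra.Properties.Semiring.Exp (CommutativeRing.semiring Y.powerSeries)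
    using () renaming (_^_ to _^ʸ_)
  open import Algebra.Properties.Semiring.Mult semiring using () renaming (_×_ to _×ᴿ_)
  open import Algebra.Properties.Semiring.Mult K.semiring using (×-assoc-*; ×-congʳ)
    renaming (_×_ to _×ᴷ_)
  open import Algebra.Properties.Semiring.Sum K.semiring using (sum; sum-cong-≋)
  open import Algebra.Properties.Semiring.Sum (CommutativeRing.semiring Y.powerSeries)
    using () renaming (sum to sumʸ)
  open import Algebra.Properties.Semiring.Sum semiring
    using () renaming (sum to sumˣʸ)
  open CommutativeSemigroupProperties *-commutativeSemigroup using (x∙yz≈yx∙z; interchange)
  open import Algebra.Properties.Ring ring using (-1*x≈-x; -‿distribˡ-*)
  open import Algebra.Properties.Ring K.ring using (-0#≈0#)
  open import Algebra.Properties.AbelianGroup +-abelianGroup using (inverseˡ-unique)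

  module ≈-Reasoning = SetoidReasoning setoid
  module K-Reasoning = SetoidReasoning K.setoid

  -- In f m n, the index m belongs to x and n to y.
  x y : Carrier
  x = X.X
  y = X.const Y.X

  scalar : K.Carrier → Carrier
  scalar k = X.const (Y.const k)

  scalar-cong : ∀ {k l} → k K.≈ l → scalar k ≈ scalar l
  scalar-cong k≈l = X.const-cong (Y.const-cong k≈l)

  scalar-0 : scalar K.0# ≈ 0#
  scalar-0 = trans (X.const-cong Y.const-0) X.const-0

  scalar-+ : ∀ k l → scalar (k K.+ l) ≈ scalar k + scalar l
  scalar-+ k l = trans (X.const-cong (Y.const-+ k l)) (X.const-+ (Y.const k) (Y.const l))

  scalar-neg-1 : scalar (K.- K.1#) ≈ - 1#
  scalar-neg-1 = inverseˡ-unique _ _ (trans (sym (scalar-+ (K.- K.1#) K.1#))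
    (trans (scalar-cong (K.-‿inverseˡ K.1#)) scalar-0))

  -- The power of y is formed among the series in y alone, because `Y.expand` delivers it there.
  monomial : ℕ → ℕ → Carrier
  monomial i j = X.const (Y.X ^ʸ j) * x ^ i

  0^n≈0 : ∀ n .{{_ : NonZero n}} → 0# ^ n ≈ 0#
  0^n≈0 (suc n) = zeroˡ (0# ^ n)

  ^-pred : ∀ f n .{{_ : NonZero n}} → f ^ n ≈ f ^ ℕ.pred n * f
  ^-pred f (suc n) = *-comm f (f ^ n)

  x-* : ∀ f m n → (x * f) (suc m) n K.≈ f m n
  x-* f m = X.X-⊛-suc f m

  x-*-zero : ∀ f n → (x * f) 0 n K.≈ K.0#
  x-*-zero f = X.X-⊛-zero f

  y-*-zero : ∀ f m → (y * f) m 0 K.≈ K.0#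
  y-*-zero f m = K.trans (X.const-⊛ Y.X f m 0) (Y.X-⊛-zero (f m))

  y-* : ∀ f m n → (y * f) m (suc n) K.≈ f m n
  y-* f m n = K.trans (X.const-⊛ Y.X f m (suc n)) (Y.X-⊛-suc (f m) n)

  scalar-* : ∀ k f m n → (scalar k * f) m n K.≈ k K.* f m n
  scalar-* k f m n = K.trans (X.const-⊛ (Y.const k) f m n) (Y.const-⊛ k (f m) n)

  sumʸ-coefficient : ∀ d (f : Fin d → Y.Series) n → sumʸ f n ≡ sum (λ i → f i n)
  sumʸ-coefficient zero    f n = ≡.refl
  sumʸ-coefficient (suc d) f n = ≡.cong (f zero n K.+_) (sumʸ-coefficient d (f ∘ suc) n)

  sum-coefficient : ∀ d (f : Fin d → Carrier) m n → sumˣʸ f m n ≡ sum (λ i → f i m n)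
  sum-coefficient zero    f m n = ≡.refl
  sum-coefficient (suc d) f m n = ≡.cong (f zero m n K.+_) (sum-coefficient d (f ∘ suc) m n)

  xDegree yDegree : Filtration X.powerSeries ℓ
  xDegree = X.degree
  yDegree = X.coefficients Y.degree
  open Filtration xDegree using () renaming (Deg to XDeg)
  open Filtration yDegree using () renaming (Deg to YDeg)

  -- Expansion in x, then of each coefficient in y. With g = 1/Q it writes f/Q in terms of the x^i
  -- y^j / Q; both the substitution and τ get their coefficients from it.
  expand² : ∀ d f g → (∀ m → d ℕ.≤ m → ∀ n → f m n K.≈ K.0#) →
            (∀ m n → d ℕ.≤ n → f m n K.≈ K.0#) →
            ∀ m n → (f * g) m n K.≈
              sum {d} (λ i → sum {d} (λ j →
                f (toℕ i) (toℕ j) K.* (monomial (toℕ i) (toℕ j) * g) m n))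
  expand² d f g dx dy m n = begin
    (f * g) m n
      ≈⟨ X.expand d f g dx m n ⟩
    sumʸ {d} (λ i → f (toℕ i) Y.⊛ (x ^ toℕ i * g) m) n
      ≡⟨ sumʸ-coefficient d _ n ⟩
    sum {d} (λ i → (f (toℕ i) Y.⊛ (x ^ toℕ i * g) m) n)
      ≈⟨ sum-cong-≋ {d} (λ i → Y.expand d (f (toℕ i)) ((x ^ toℕ i * g) m) (dy (toℕ i)) n) ⟩
    sum {d} (λ i → sum {d} (λ j → f (toℕ i) (toℕ j) K.* (Y.X ^ʸ toℕ j Y.⊛ (x ^ toℕ i * g) m) n))
      ≈⟨ sum-cong-≋ {d} (λ i → sum-cong-≋ {d} (λ j → K.*-congˡ (K.trans
           (K.sym (X.const-⊛ (Y.X ^ʸ toℕ j) (x ^ toℕ i * g) m n))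
           (K.sym (*-assoc (X.const (Y.X ^ʸ toℕ j)) (x ^ toℕ i) g m n))))) ⟩
    sum {d} (λ i → sum {d} (λ j → f (toℕ i) (toℕ j) K.* (monomial (toℕ i) (toℕ j) * g) m n)) ∎
    where open K-Reasoning

  monomial-xDegree : ∀ i j → XDeg (i ℕ.* 1) (monomial i j)
  monomial-xDegree i j = Filtration.*-deg xDegree {0} X.const-degree
    (Filtration.^-deg xDegree i X.X-degree)

  monomial-yDegree : ∀ i j → YDeg (j ℕ.* 1 ℕ.+ i ℕ.* 0) (monomial i j)
  monomial-yDegree i j = Filtration.*-deg yDegree
    (X.const-coefficients Y.degree (Filtration.^-deg Y.degree j Y.X-degree))
    (Filtration.^-deg yDegree i (X.X-coefficients Y.degree))

  -- Inversion is used twice: for `f 0` as a series in y, and then for f as a series in x with that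
  -- leading coefficient.
  invertible : ∀ f → f 0 0 K.≈ K.1# → ∃ λ g → f * g ≈ 1#
  invertible f f₀₀≈1 = X.Inverse.inverse f _ f₀⁻¹ , X.Inverse.⊛-inverse f _ f₀⁻¹
    where f₀⁻¹ = Y.Inverse.⊛-inverse (f 0) K.1# (K.trans (K.*-identityʳ _) f₀₀≈1)

  -- Sections of a series modulo p and the p-th power

  module Characteristic {p} (p-prime : Prime p) (char : p ×ᴷ K.1# K.≈ K.0#)
                        (generated : ∀ k → ∃ λ n → k K.≈ n ×ᴷ K.1#) where

    private instance
      _ = prime⇒nonZero p-prime

    ×-coefficient : ∀ n f i j → (n ×ᴿ f) i j ≡ n ×ᴷ f i j
    ×-coefficient zero    f i j = ≡.refl
    ×-coefficient (suc n) f i j = ≡.cong (f i j K.+_) (×-coefficient n f i j)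

    p×≈0 : ∀ f → p ×ᴿ f ≈ 0#
    p×≈0 f i j = begin
      (p ×ᴿ f) i j             ≡⟨ ×-coefficient p f i j ⟩
      p ×ᴷ f i j               ≈⟨ ×-congʳ p (K.*-identityˡ (f i j)) ⟨
      p ×ᴷ (K.1# K.* f i j)    ≈⟨ ×-assoc-* p K.1# (f i j) ⟨
      (p ×ᴷ K.1#) K.* f i j    ≈⟨ K.*-congʳ char ⟩
      K.0# K.* f i j           ≈⟨ K.zeroˡ (f i j) ⟩
      K.0#                     ∎
      where open K-Reasoning

    -- The Cartier operators. They read exactly the points pα + β with β = (i, j) on which
    -- invariance imposes its condition.
    section : Fin p → Fin p → Carrier → Carrier
    section i j f m n = f (p ℕ.* m ℕ.+ toℕ i) (p ℕ.* n ℕ.+ toℕ j)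

    section-cong : ∀ {i j f g} → f ≈ g → section i j f ≈ section i j g
    section-cong f≈g m n = f≈g _ _

    -- f(x,y)ᵖ = f(xᵖ,yᵖ), expressed through the sections so that no substitution map is needed.
    Frobenius-linear : Carrier → Set (c ⊔ ℓ)
    Frobenius-linear f = ∀ i j g → section i j (f ^ p * g) ≈ f * section i j g

    linear-resp : ∀ {f g} → f ≈ g → Frobenius-linear f → Frobenius-linear g
    linear-resp {f} {g} f≈g lin i j h = begin
      section i j (g ^ p * h) ≈⟨ section-cong (*-congʳ (^-congˡ p f≈g)) ⟨
      section i j (f ^ p * h) ≈⟨ lin i j h ⟩
      f * section i j h       ≈⟨ *-congʳ f≈g ⟩
      g * section i j h       ∎
      where open ≈-Reasoning

    1-linear : Frobenius-linear 1#
    1-linear i j h = begin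
      section i j (1# ^ p * h) ≈⟨ section-cong (*-congʳ (1^ p)) ⟩
      section i j (1# * h)     ≈⟨ section-cong (*-identityˡ h) ⟩
      section i j h            ≈⟨ *-identityˡ _ ⟨
      1# * section i j h       ∎
      where
      open ≈-Reasoning
      1^ : ∀ n → 1# ^ n ≈ 1#
      1^ zero    = refl
      1^ (suc n) = trans (*-identityˡ _) (1^ n)

    open Frobenius X.powerSeries p-prime using (^p-distrib-+)

    +-linear : ∀ {f g} → Frobenius-linear f → Frobenius-linear g → Frobenius-linear (f + g)
    +-linear {f} {g} lf lg i j h = begin
      section i j ((f + g) ^ p * h)
        ≈⟨ section-cong (trans (*-congʳ (^p-distrib-+ p×≈0 f g)) (distribʳ h _ _)) ⟩
      section i j (f ^ p * h) + section i j (g ^ p * h)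
        ≈⟨ +-cong (lf i j h) (lg i j h) ⟩
      f * section i j h + g * section i j h
        ≈⟨ distribʳ _ f g ⟨
      (f + g) * section i j h ∎
      where open ≈-Reasoning

    *-linear : ∀ {f g} → Frobenius-linear f → Frobenius-linear g → Frobenius-linear (f * g)
    *-linear {f} {g} lf lg i j h = begin
      section i j ((f * g) ^ p * h)
        ≈⟨ section-cong (trans (*-congʳ (^-distrib-* f g p)) (*-assoc (f ^ p) (g ^ p) h)) ⟩
      section i j (f ^ p * (g ^ p * h))
        ≈⟨ lf i j _ ⟩
      f * section i j (g ^ p * h)
        ≈⟨ *-congˡ (lg i j h) ⟩
      f * (g * section i j h)
        ≈⟨ *-assoc f g _ ⟨
      f * g * section i j h ∎
      where open ≈-Reasoning

    0-linear : Frobenius-linear 0#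
    0-linear i j h = trans (section-cong (trans (*-congʳ (0^n≈0 p)) (zeroˡ h))) (sym (zeroˡ _))

    ×1-linear : ∀ n → Frobenius-linear (scalar (n ×ᴷ K.1#))
    ×1-linear zero    = linear-resp (sym scalar-0) 0-linear
    ×1-linear (suc n) = linear-resp (sym (scalar-+ K.1# (n ×ᴷ K.1#)))
      (+-linear 1-linear (×1-linear n))

    scalar-linear : ∀ k → Frobenius-linear (scalar k)
    scalar-linear k with n , k≈n ← generated k = linear-resp (sym (scalar-cong k≈n)) (×1-linear n)

    -- -f is the constant -1 times f, so the parity of p never matters.
    neg-linear : ∀ {f} → Frobenius-linear f → Frobenius-linear (- f)
    neg-linear {f} lf = linear-resp (trans (*-congʳ scalar-neg-1) (-1*x≈-x f))
      (*-linear (scalar-linear (K.- K.1#)) lf)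

    x-linear : Frobenius-linear x
    x-linear i j h m n = K.trans (X.X^-⊛-section p (Fin.toℕ<n i) h m (p ℕ.* n ℕ.+ toℕ j)) (shift m)
      where
      -- The outer index is settled; it remains that multiplication by x commutes with restricting
      -- the inner index.
      shift : ∀ m → (x * λ m → h (p ℕ.* m ℕ.+ toℕ i)) m (p ℕ.* n ℕ.+ toℕ j) K.≈
                    (x * section i j h) m n
      shift zero    = K.trans (X.X-⊛-zero (λ m → h (p ℕ.* m ℕ.+ toℕ i)) (p ℕ.* n ℕ.+ toℕ j))
                        (K.sym (X.X-⊛-zero (section i j h) n))
      shift (suc m) = K.trans (x-* (λ m → h (p ℕ.* m ℕ.+ toℕ i)) m (p ℕ.* n ℕ.+ toℕ j))
                        (K.sym (x-* (section i j h) m n))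

    y^-* : ∀ k h m → (y ^ k * h) m Y.≋ (Y.X ^ʸ k Y.⊛ h m)
    y^-* zero    h m n = K.trans (*-identityˡ h m n) (K.sym (Y.⊛-identityˡ (h m) n))
    y^-* (suc k) h m = Y.S.trans (*-assoc y (y ^ k) h m) (Y.S.trans (X.const-⊛ Y.X (y ^ k * h) m)
      (Y.S.trans (Y.S.*-congˡ {Y.X} (y^-* k h m)) (Y.S.sym (Y.S.*-assoc Y.X (Y.X ^ʸ k) (h m)))))

    y-linear : Frobenius-linear y
    y-linear i j h m n = begin
      (y ^ p * h) (p ℕ.* m ℕ.+ toℕ i) (p ℕ.* n ℕ.+ toℕ j)
        ≈⟨ y^-* p h (p ℕ.* m ℕ.+ toℕ i) (p ℕ.* n ℕ.+ toℕ j) ⟩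
      (Y.X ^ʸ p Y.⊛ h (p ℕ.* m ℕ.+ toℕ i)) (p ℕ.* n ℕ.+ toℕ j)
        ≈⟨ Y.X^-⊛-section p (Fin.toℕ<n j) (h (p ℕ.* m ℕ.+ toℕ i)) n ⟩
      (Y.X Y.⊛ section i j h m) n
        ≈⟨ X.const-⊛ Y.X (section i j h) m n ⟨
      (y * section i j h) m n ∎
      where open K-Reasoning

    -- In the form of a filtration, the property passes to determinants by `⋀-deg`.
    linear : Filtration X.powerSeries (c ⊔ ℓ)
    linear = record
      { Deg     = λ _ → Frobenius-linear
      ; 0-deg   = 0-linear
      ; 1-deg   = 1-linear
      ; +-deg   = +-linear
      ; neg-deg = neg-linear
      ; *-deg   = *-linear
      }

    -- With g = 1/f: the series h/f is h fᵖ⁻¹ / fᵖ, and fᵖ leaves the section as f.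
    section-quotient : ∀ {f g} → Frobenius-linear f → f * g ≈ 1# → ∀ i j h →
                       section i j (h * g) ≈ section i j (h * f ^ ℕ.pred p) * g
    section-quotient {f} {g} lin fg≈1 i j h = begin
      section i j (h * g)                ≈⟨ *-identityʳ _ ⟨
      section i j (h * g) * 1#           ≈⟨ *-congˡ fg≈1 ⟨
      section i j (h * g) * (f * g)      ≈⟨ x∙yz≈yx∙z _ f g ⟩
      f * section i j (h * g) * g        ≈⟨ *-congʳ (lin i j (h * g)) ⟨
      section i j (f ^ p * (h * g)) * g  ≈⟨ *-congʳ (section-cong clear) ⟩
      section i j (h * f ^ ℕ.pred p) * g ∎
      where
      open ≈-Reasoning
      clear : f ^ p * (h * g) ≈ h * f ^ ℕ.pred p
      clear = begin
        f ^ p * (h * g)              ≈⟨ *-congʳ (^-pred f p) ⟩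
        f ^ ℕ.pred p * f * (h * g)   ≈⟨ interchange _ f h g ⟩
        f ^ ℕ.pred p * h * (f * g)   ≈⟨ *-cong (*-comm _ h) fg≈1 ⟩
        h * f ^ ℕ.pred p * 1#        ≈⟨ *-identityʳ _ ⟩
        h * f ^ ℕ.pred p             ∎

    -- Series with denominator det(1 - ax - by - cxy), for matrices of size d + 1

    module RationalMatrix {d} (a b c : Fin (suc d) → Fin (suc d) → K.Carrier) where

      open Exterior X.powerSeries
        using (unit; unit-deg; det; det-solution; cofactor; sum-unit; ⋀-deg; ⋀-update-deg)
      open import Algebra.Properties.Semiring.Sum semiring using ()
        renaming (sum to Σ; sum-cong-≋ to Σ-cong;
                  *-distribˡ-sum to *-distribˡ-Σ; ∑-distrib-+ to Σ-distrib-+)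

      step : Fin (suc d) → Fin (suc d) → Carrier
      step i k = scalar (a i k) * x + scalar (b i k) * y + scalar (c i k) * (x * y)

      step-constant : ∀ i k → step i k 0 0 K.≈ K.0#
      step-constant i k = K.trans
        (K.+-cong (K.trans (K.+-cong (K.zeroʳ _) (K.zeroʳ _)) (K.+-identityʳ _))
          (K.trans (K.*-congˡ (K.zeroʳ _)) (K.zeroʳ _))) (K.+-identityʳ _)

      step-* : ∀ i k f m n → (step i k * f) m n K.≈
               a i k K.* (x * f) m n K.+ b i k K.* (y * f) m n K.+ c i k K.* (x * (y * f)) m n
      step-* i k f m n = K.trans
        (trans (distribʳ f (scalar (a i k) * x + scalar (b i k) * y) (scalar (c i k) * (x * y)))
          (+-cong
            (trans (distribʳ f (scalar (a i k) * x) (scalar (b i k) * y))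
              (+-cong (*-assoc (scalar (a i k)) x f) (*-assoc (scalar (b i k)) y f)))
            (trans (*-assoc (scalar (c i k)) (x * y) f)
              (*-congˡ {scalar (c i k)} (*-assoc x y f)))) m n)
        (K.+-cong (K.+-cong (scalar-* (a i k) (x * f) m n) (scalar-* (b i k) (y * f) m n))
          (scalar-* (c i k) (x * (y * f)) m n))

      unit-constant : ∀ (i j : Fin (suc d)) → unit i j 0 0 K.≈ Exterior.unit K i j
      unit-constant i j with does (i Fin.≟ j)
      ... | true  = K.refl
      ... | false = K.refl

      unit-xCoefficient : ∀ (i j : Fin (suc d)) m n → unit i j (suc m) n K.≈ K.0#
      unit-xCoefficient i j m n with does (i Fin.≟ j)
      ... | true  = K.refl
      ... | false = K.refl

      unit-yCoefficient : ∀ (i j : Fin (suc d)) n → unit i j 0 (suc n) K.≈ K.0#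
      unit-yCoefficient i j n with does (i Fin.≟ j)
      ... | true  = K.refl
      ... | false = K.refl

      -- The columns of 1 − ax − by − cxy.
      columns : Fin (suc d) → Fin (suc d) → Carrier
      columns j i = unit i j - step i j

      Q : Carrier
      Q = det columns

      module _ {r} (Φ : Filtration X.powerSeries r) where
        open Filtration Φ

        -- The hypotheses concern whole terms: xy has degree 1 in each variable separately, whereas
        -- degree 1 for both x and y would only give 2 for the product.
        columns-degree : (∀ k → Deg 1 (scalar k * x)) → (∀ k → Deg 1 (scalar k * y)) →
                         (∀ k → Deg 1 (scalar k * (x * y))) → ∀ j i → Deg 1 (columns j i)
        columns-degree dx dy dxy j i = +-deg (unit-deg Φ i j)
          (neg-deg (+-deg (+-deg (dx (a i j)) (dy (b i j))) (dxy (c i j))))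

      columns-xDegree : ∀ j i → XDeg 1 (columns j i)
      columns-xDegree = columns-degree xDegree
        (λ k → *-deg {0} X.const-degree X.X-degree)
        (λ k → *-deg {0} X.const-degree X.const-degree)
        (λ k → *-deg {0} X.const-degree (*-deg {1} {0} X.X-degree X.const-degree))
        where open Filtration xDegree

      columns-yDegree : ∀ j i → YDeg 1 (columns j i)
      columns-yDegree = columns-degree yDegree
        (λ k → *-deg {0} (constant k) (X.X-coefficients Y.degree))
        (λ k → *-deg {0} (constant k) y-degree)
        (λ k → *-deg {0} (constant k) (*-deg {0} (X.X-coefficients Y.degree) y-degree))
        where
        open Filtration yDegree
        constant : ∀ k → YDeg 0 (scalar k)
        constant k = X.const-coefficients Y.degree Y.const-degree
        y-degree : YDeg 1 y
        y-degree = X.const-coefficients Y.degree Y.X-degree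

      Q-linear : Frobenius-linear Q
      Q-linear = ⋀-deg linear (columns-degree linear
        (λ k → *-linear (scalar-linear k) x-linear)
        (λ k → *-linear (scalar-linear k) y-linear)
        (λ k → *-linear (scalar-linear k) (*-linear x-linear y-linear))) full

      -- At x = y = 0 the columns become unit vectors.
      Q₀₀≈1 : Q 0 0 K.≈ K.1#
      Q₀₀≈1 = K.trans (⋀-constant Y.powerSeries columns full 0)
        (K.trans (⋀-constant K (λ j i → columns j i 0) full)
          (K.trans (Exterior.⋀-cong K constant full) (Exterior.det-unit K (suc d))))
        where
        constant : ∀ j i → columns j i 0 0 K.≈ Exterior.unit K j i
        constant j i = K.trans
          (K.+-cong (K.trans (unit-constant i j) (K.reflexive (Exterior.unit-sym K i j)))
            (K.trans (K.-‿cong (step-constant i j)) -0#≈0#)) (K.+-identityʳ _)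

      G : Carrier
      G = proj₁ (invertible Q Q₀₀≈1)

      Q*G≈1 : Q * G ≈ 1#
      Q*G≈1 = proj₂ (invertible Q Q₀₀≈1)

      basis : Fin (suc d) → Fin (suc d) → Carrier
      basis k l = monomial (toℕ k) (toℕ l) * G

      numerator : Fin p → Fin p → Fin (suc d) → Fin (suc d) → Carrier
      numerator i j k l = section i j (monomial (toℕ k) (toℕ l) * Q ^ ℕ.pred p)

      -- Since e < d + 1, the degree e + (p - 1)(d + 1) lies below p(d + 1), hence below pm + i once
      -- m ≥ d + 1. So a section of the numerator again has degree at most d. The name e absorbs the
      -- unreduced bounds that the filtrations produce.
      degree-bound : ∀ (k : Fin (suc d)) {e m} i → e ≡ toℕ k → suc d ℕ.≤ m →
                     e ℕ.+ ℕ.pred p ℕ.* suc d ℕ.< p ℕ.* m ℕ.+ i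
      degree-bound k {m = m} i ≡.refl d<m = ℕ.<-≤-trans
        (ℕ.+-monoˡ-< (ℕ.pred p ℕ.* suc d) (Fin.toℕ<n k))
        (ℕ.≤-trans (ℕ.≤-reflexive (≡.cong (ℕ._* suc d) (ℕ.suc-pred p)))
          (ℕ.≤-trans (ℕ.*-monoʳ-≤ p d<m) (ℕ.m≤m+n (p ℕ.* m) i)))

      basis-section : ∀ i j k l m n → section i j (basis k l) m n K.≈
        sum (λ k′ → sum (λ l′ → numerator i j k l (toℕ k′) (toℕ l′) K.* basis k′ l′ m n))
      basis-section i j k l m n = K.trans
        (section-quotient Q-linear Q*G≈1 i j (monomial (toℕ k) (toℕ l)) m n)
        (expand² (suc d) (numerator i j k l) G
          (λ m d<m n → Filtration.*-deg xDegree (monomial-xDegree (toℕ k) (toℕ l))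
            (Filtration.^-deg xDegree (ℕ.pred p) (⋀-deg xDegree columns-xDegree full)) _
            (degree-bound k (toℕ i) (ℕ.*-identityʳ (toℕ k)) d<m) _)
          (λ m n d<n → Filtration.*-deg yDegree (monomial-yDegree (toℕ k) (toℕ l))
            (Filtration.^-deg yDegree (ℕ.pred p) (⋀-deg yDegree columns-yDegree full))
            (p ℕ.* m ℕ.+ toℕ i) (p ℕ.* n ℕ.+ toℕ j)
            (degree-bound l (toℕ j) 
              (≡.trans (≡.cong₂ ℕ._+_ (ℕ.*-identityʳ (toℕ l)) (ℕ.*-zeroʳ (toℕ k)))
                (ℕ.+-identityʳ (toℕ l))) d<n))
          m n)

      adjugate : Fin (suc d) → Fin (suc d) → Carrier
      adjugate = cofactor columns

      module _ (F : Fin (suc d) → Fin (suc d) → Carrier)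
               (recurrence : ∀ i j → F i j ≈ unit i j + Σ (λ k → step i k * F k j)) where

        solution : ∀ i j → Σ (λ k → columns k i * F k j) ≈ unit i j
        solution i j = begin
          Σ (λ k → (unit i k - step i k) * F k j)
            ≈⟨ Σ-cong {suc d} (λ k → trans (distribʳ (F k j) (unit i k) (- step i k))
                 (+-congˡ {unit i k * F k j}
                   (trans (sym (-‿distribˡ-* (step i k) (F k j)))
                     (sym (-1*x≈-x (step i k * F k j)))))) ⟩
          Σ (λ k → unit i k * F k j + - 1# * (step i k * F k j))
            ≈⟨ Σ-distrib-+ {suc d} (λ k → unit i k * F k j) (λ k → - 1# * (step i k * F k j)) ⟩
          Σ (λ k → unit i k * F k j) + Σ (λ k → - 1# * (step i k * F k j))
            ≈⟨ +-cong (sum-unit i (λ k → F k j))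
                 (sym (*-distribˡ-Σ {suc d} (- 1#) (λ k → step i k * F k j))) ⟩
          F i j + - 1# * S
            ≈⟨ +-cong (recurrence i j) (-1*x≈-x S) ⟩
          unit i j + S - S
            ≈⟨ trans (+-assoc (unit i j) S (- S))
                 (trans (+-congˡ {unit i j} (-‿inverseʳ S)) (+-identityʳ (unit i j))) ⟩
          unit i j ∎
          where
          open ≈-Reasoning
          S = Σ (λ k → step i k * F k j)

        -- Cramer's rule `det-solution` gives QF, and the factor G = 1/Q removes Q.
        F≈adjugate*G : ∀ i j → F i j ≈ adjugate i j * G
        F≈adjugate*G i j = begin
          F i j            ≈⟨ *-identityʳ (F i j) ⟨
          F i j * 1#       ≈⟨ *-congˡ {F i j} Q*G≈1 ⟨
          F i j * (Q * G)  ≈⟨ x∙yz≈yx∙z (F i j) Q G ⟩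
          Q * F i j * G    ≈⟨ *-congʳ {G} (det-solution columns F solution i j) ⟩
          adjugate i j * G ∎
          where open ≈-Reasoning

        -- Cofactors of size d + 1 have degree at most d in each variable, so the (d + 1)² series of
        -- `basis` suffice, as many as a colour has entries.
        F-expansion : ∀ i j m n → F i j m n K.≈
          sum (λ k → sum (λ l → adjugate i j (toℕ k) (toℕ l) K.* basis k l m n))
        F-expansion i j m n = K.trans (F≈adjugate*G i j m n)
          (expand² (suc d) (adjugate i j) G
            (λ m d<m n → ⋀-update-deg xDegree i columns-xDegree (unit-deg xDegree j) full m d<m n)
            (λ m n d<n → ⋀-update-deg yDegree i columns-yDegree (unit-deg yDegree j) full m n d<n)
            m n)

-- Linear maps on matrices, and the tiling

open import Data.Integer as ℤ using (+_; -[1+_]; 0ℤ; 1ℤ)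
import Data.Integer.Properties as ℤ

power-linear : {R : Set} (A B : RawLeftModule R 0ℓ 0ℓ) (E : Set)
               (f : RawLeftModule.Carrierᴹ A → E → RawLeftModule.Carrierᴹ B) →
               (∀ e → Linear A B (λ x → f x e)) → Linear A (powerModule B E) f
power-linear A B E f linear = record
  { +ᴹ-isGroupHomomorphism = record
    { isMonoidHomomorphism = record
      { isMagmaHomomorphism = record
        { isRelHomomorphism = record { cong = λ x≈y e → L.⟦⟧-cong e x≈y }
        ; homo = λ x y e → L.+ᴹ-homo e x y
        }
      ; ε-homo = λ e → L.0ᴹ-homo e
      }
    ; ⁻¹-homo = λ x e → L.-ᴹ-homo e x
    }
  ; *ₗ-homo = λ r x e → L.*ₗ-homo e r x
  }
  where
  open import Algebra.Module.Morphism.Structures using (IsLeftModuleHomomorphism)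
  module L e = IsLeftModuleHomomorphism (linear e)

module _ (p : ℕ) .{{_ : NonZero p}} {d : ℕ} where
  private
    module K = CommutativeRing (𝔽-commutativeRing p)
  open K using (Carrier; _+_; _*_; -_; 0#; 1#)
  open Matrices (𝔽 p) hiding (Mat; matrixModule)
  open import Algebra.Properties.Semiring.Sum K.semiring
    using (sum-cong-≗; ∑-distrib-+; *-distribˡ-sum) renaming (sum to Σ)
  open import Algebra.Properties.Ring K.ring using (-1*x≈-x)
  open ≡.≡-Reasoning

  matrix-ext : ∀ {A B : Mat (𝔽 p) d} → (∀ i j → entry A i j ≡ entry B i j) → A ≡ B
  matrix-ext {A} {B} p = ext λ i → ext (p i)
    where
    ext : ∀ {X : Set} {n} {xs ys : Vec X n} → lookup xs ≗ lookup ys → xs ≡ ys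
    ext {xs = xs} {ys} q = ≡.trans (≡.sym (tabulate∘lookup xs))
      (≡.trans (tabulate-cong q) (tabulate∘lookup ys))

  entry-matrix : ∀ (f : Fin d → Fin d → Carrier) i j → entry (matrix f) i j ≡ f i j
  entry-matrix f i j = ≡.trans (≡.cong (λ r → lookup r j) (lookup∘tabulate _ i))
    (lookup∘tabulate (f i) j)

  entry-+ : ∀ (A B : Mat (𝔽 p) d) i j → entry (A +ᴹ B) i j ≡ entry A i j + entry B i j
  entry-+ A B i j = ≡.trans (≡.cong (λ r → lookup r j) (lookup-zipWith _ i A B))
    (lookup-zipWith _ j (lookup A i) (lookup B i))

  entry-* : ∀ (A B : Mat (𝔽 p) d) i j → entry (A *ᴹ B) i j ≡ Σ (λ k → entry A i k * entry B k j)
  entry-* A B = entry-matrix (λ i j → Σ (λ k → entry A i k * entry B k j))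

  entry-0 : ∀ (i j : Fin d) → entry 0ᴹ i j ≡ 0#
  entry-0 i j = ≡.trans (≡.cong (λ r → lookup r j) (lookup-replicate i _)) (lookup-replicate j 0#)

  entry-· : ∀ r (A : Mat (𝔽 p) d) i j → entry (r · A) i j ≡ r * entry A i j
  entry-· r A i j = ≡.trans (≡.cong (λ r → lookup r j) (lookup-map i _ A))
    (lookup-map j _ (lookup A i))

  -- Stated with the factor -1 so that negation becomes a case of `homogeneous` below.
  entry-neg : ∀ (A : Mat (𝔽 p) d) i j → entry (-ᴹ A) i j ≡ - 1# * entry A i j
  entry-neg A i j = ≡.trans (≡.cong (λ r → lookup r j) (lookup-map i _ A))
    (≡.trans (lookup-map j _ (lookup A i)) (≡.sym (-1*x≈-x (entry A i j))))

  form : (c f : Fin d → Fin d → Carrier) → Carrier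
  form c f = Σ (λ i → Σ (λ j → c i j * f i j))

  form-cong : ∀ c {f g} → (∀ i j → f i j ≡ g i j) → form c f ≡ form c g
  form-cong c f≡g = sum-cong-≗ {d} λ i → sum-cong-≗ {d} λ j → ≡.cong (c i j *_) (f≡g i j)

  form-+ : ∀ c f g → form c (λ i j → f i j + g i j) ≡ form c f + form c g
  form-+ c f g = ≡.trans
    (sum-cong-≗ {d} λ i → ≡.trans (sum-cong-≗ {d} λ j → K.distribˡ (c i j) (f i j) (g i j))
      (∑-distrib-+ {d} (λ j → c i j * f i j) (λ j → c i j * g i j)))
    (∑-distrib-+ {d} (λ i → Σ λ j → c i j * f i j) (λ i → Σ λ j → c i j * g i j))

  form-* : ∀ c r f → form c (λ i j → r * f i j) ≡ r * form c f
  form-* c r f = ≡.trans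
    (sum-cong-≗ {d} λ i → ≡.trans (sum-cong-≗ {d} λ j → x∙yz≈y∙xz (c i j) r (f i j))
      (≡.sym (*-distribˡ-sum {d} r (λ j → c i j * f i j))))
    (≡.sym (*-distribˡ-sum {d} r (λ i → Σ λ j → c i j * f i j)))
    where open CommutativeSemigroupProperties K.*-commutativeSemigroup using (x∙yz≈y∙xz)

  form-0 : ∀ c → form c (λ _ _ → 0#) ≡ 0#
  form-0 c = ≡.trans (form-cong c (λ _ _ → ≡.sym (K.zeroˡ 0#)))
    (≡.trans (form-* c 0# (λ _ _ → 0#)) (K.zeroˡ (form c (λ _ _ → 0#))))

  -- A general endomorphism of the d²-dimensional space of matrices, c being its d² × d² coefficient
  -- array; multiplications by a fixed matrix would not suffice.
  linearMap : (Fin d → Fin d → Fin d → Fin d → Carrier) → Mat (𝔽 p) d → Mat (𝔽 p) d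
  linearMap c A = matrix λ k l → form (c k l) (entry A)

  entry-linearMap : ∀ c A k l → entry (linearMap c A) k l ≡ form (c k l) (entry A)
  entry-linearMap c A = entry-matrix (λ k l → form (c k l) (entry A))

  linearMap-0 : ∀ c → linearMap c 0ᴹ ≡ 0ᴹ
  linearMap-0 c = matrix-ext λ k l → begin
    entry (linearMap c 0ᴹ) k l     ≡⟨ entry-linearMap c 0ᴹ k l ⟩
    form (c k l) (entry 0ᴹ)        ≡⟨ form-cong (c k l) entry-0 ⟩
    form (c k l) (λ _ _ → 0#)      ≡⟨ form-0 (c k l) ⟩
    0#                             ≡⟨ entry-0 k l ⟨
    entry 0ᴹ k l                   ∎

  linearMap-linear : ∀ c → Linear (matrixModule (𝔽 p) d) (matrixModule (𝔽 p) d) (linearMap c)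
  linearMap-linear c = record
    { +ᴹ-isGroupHomomorphism = record
      { isMonoidHomomorphism = record
        { isMagmaHomomorphism = record
          { isRelHomomorphism = record { cong = ≡.cong (linearMap c) }
          ; homo = λ A B → matrix-ext λ k l → begin
              entry (linearMap c (A +ᴹ B)) k l
                ≡⟨ entry-linearMap c (A +ᴹ B) k l ⟩
              form (c k l) (entry (A +ᴹ B))
                ≡⟨ form-cong (c k l) (entry-+ A B) ⟩
              form (c k l) (λ i j → entry A i j + entry B i j)
                ≡⟨ form-+ (c k l) (entry A) (entry B) ⟩
              form (c k l) (entry A) + form (c k l) (entry B)
                ≡⟨ ≡.cong₂ _+_ (entry-linearMap c A k l) (entry-linearMap c B k l) ⟨
              entry (linearMap c A) k l + entry (linearMap c B) k l
                ≡⟨ entry-+ (linearMap c A) (linearMap c B) k l ⟨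
              entry (linearMap c A +ᴹ linearMap c B) k l ∎
          }
        ; ε-homo = linearMap-0 c
        }
      ; ⁻¹-homo = λ A → homogeneous (- 1#) (-ᴹ_) entry-neg A
      }
    ; *ₗ-homo = λ r A → homogeneous r (r ·_) (entry-· r) A
    }
    where
    homogeneous : ∀ r (op : Mat (𝔽 p) d → Mat (𝔽 p) d) →
                  (∀ A i j → entry (op A) i j ≡ r * entry A i j) →
                  ∀ A → linearMap c (op A) ≡ op (linearMap c A)
    homogeneous r op entry-op A = matrix-ext λ k l → begin
      entry (linearMap c (op A)) k l           ≡⟨ entry-linearMap c (op A) k l ⟩
      form (c k l) (entry (op A))              ≡⟨ form-cong (c k l) (entry-op A) ⟩
      form (c k l) (λ i j → r * entry A i j)   ≡⟨ form-* (c k l) r (entry A) ⟩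
      r * form (c k l) (entry A)               ≡⟨ ≡.cong (r *_) (entry-linearMap c A k l) ⟨
      r * entry (linearMap c A) k l            ≡⟨ entry-op (linearMap c A) k l ⟨
      entry (op (linearMap c A)) k l           ∎

⊛-pos : ∀ ℓ m i → + ℓ ℤ.* + m ℤ.+ + i ≡ + (ℓ ℕ.* m ℕ.+ i)
⊛-pos ℓ m i = ≡.cong (ℤ._+ + i) (≡.sym (ℤ.pos-* ℓ m))

-- As i < ℓ, the offset cannot lift a negative multiple of ℓ to 0. Thus pα + β stays outside the
-- quadrant whenever α does.
⊛-neg : ∀ {ℓ i} → i ℕ.< ℓ → ∀ m → ∃ λ n → + ℓ ℤ.* -[1+ m ] ℤ.+ + i ≡ -[1+ n ]
⊛-neg {suc ℓ} {i} (s≤s i≤ℓ) m = ⊖-neg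
  (s≤s (ℕ.≤-trans i≤ℓ (ℕ.≤-trans (ℕ.m≤m*n ℓ (suc m)) (ℕ.m≤n+m _ m))))
  where
  ⊖-neg : ∀ {i n} → i ℕ.< n → ∃ λ k → i ℤ.⊖ n ≡ -[1+ k ]
  ⊖-neg {zero}  (s≤s {n = n} _) = n , ≡.refl
  ⊖-neg {suc i} (s≤s {n = n} i<n) with k , eq ← ⊖-neg i<n = k , ≡.trans (ℤ.[1+m]⊖[1+n]≡m⊖n i n) eq

corollary1p6 : (p : ℕ) .{{_ : NonZero p}} → Prime p →
    (d : ℕ) → d ≥ 1 →
    (a b c : Mat (𝔽 p) d) →
    (M : Tiling (Mat (𝔽 p) d)) → RecursivelyDefined (𝔽 p) a b c M →
    Σ[ T ∈ Tiling (Mat (𝔽 p) d) ]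
    (Σ[ S ∈ Substitution p (Mat (𝔽 p) d) ]
    (LinearSubstitution (matrixModule (𝔽 p) d) p S × Invariant p S T))
    × (Σ[ τ ∈ (Mat (𝔽 p) d → Mat (𝔽 p) d) ]
    (Linear (matrixModule (𝔽 p) d) (matrixModule (𝔽 p) d) τ × M ≗ τ ∘ T))
corollary1p6 p p-prime (suc d) _ a b c M rec =
  T , (S , S-linear , invariant) , (τ , linearMap-linear p τ-coefficient , M≗τ∘T)
  where
  module K = CommutativeRing (𝔽-commutativeRing p)
  open Matrices (𝔽 p) hiding (Mat; matrixModule)
  open RecursivelyDefined rec renaming (outside to M-outside)
  open Bivariate (𝔽-commutativeRing p)
    using (module Characteristic; x; y; x-*; y-*; x-*-zero; y-*-zero; sum-coefficient; semiring)
    renaming (Carrier to Series²; _*_ to _*ˢ_; _+_ to _+ˢ_; _≈_ to _≈ˢ_)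
  open Characteristic p-prime (𝔽-characteristic p) (𝔽-generated p)
  open RationalMatrix (entry a) (entry b) (entry c)
  open import Algebra.Properties.Semiring.Sum K.semiring
    using (sum-cong-≗; ∑-distrib-+; sum-replicate-zero) renaming (sum to Σ)
  open import Algebra.Properties.Semiring.Sum semiring using () renaming (sum to Σˢ)
  open Exterior (PowerSeries.powerSeries (PowerSeries.powerSeries (𝔽-commutativeRing p))) using (unit)
  open ≡.≡-Reasoning

  T : Tiling (Mat (𝔽 p) (suc d))
  T (+ m , + n) = matrix λ k l → basis k l m n
  -- The colour 0 is sent to the zero block by every linear substitution, so invariance survives
  -- outside the quadrant.
  T _           = 0ᴹ

  S-coefficient : Cell p → (k l k′ l′ : Fin (suc d)) → Fin p
  S-coefficient (i , j) k l k′ l′ = numerator i j k l (toℕ k′) (toℕ l′)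

  S : Substitution p (Mat (𝔽 p) (suc d))
  S A β = linearMap p (S-coefficient β) A

  S-linear : LinearSubstitution (matrixModule (𝔽 p) (suc d)) p S
  S-linear = power-linear _ _ _ S (λ β → linearMap-linear p (S-coefficient β))

  linearMap-T : ∀ e m n k l → entry (linearMap p e (T (+ m , + n))) k l ≡
                Σ (λ i → Σ (λ j → e k l i j K.* basis i j m n))
  linearMap-T e m n k l = ≡.trans (entry-linearMap p e (T (+ m , + n)) k l)
    (form-cong p (e k l) (entry-matrix p (λ k l → basis k l m n)))

  -- `T` matches on the first coordinate first, so it reduces here only once the sign of m is known.
  T-negʳ : ∀ m n → T (m , -[1+ n ]) ≡ 0ᴹ
  T-negʳ (+ m)    n = ≡.refl
  T-negʳ -[1+ m ] n = ≡.refl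

  invariant : Invariant p S T
  invariant (+ m , + n) (i , j) = ≡.trans
    (≡.cong₂ (λ u v → T (u , v)) (⊛-pos p m (toℕ i)) (⊛-pos p n (toℕ j)))
    (matrix-ext p λ k l → begin
      entry (T (+ (p ℕ.* m ℕ.+ toℕ i) , + (p ℕ.* n ℕ.+ toℕ j))) k l
        -- The entry of `T` at pα + β is by definition a section of the basis series.
        ≡⟨ entry-matrix p (λ k l → section i j (basis k l) m n) k l ⟩
      section i j (basis k l) m n
        ≡⟨ basis-section i j k l m n ⟩
      Σ (λ k′ → Σ (λ l′ → S-coefficient (i , j) k l k′ l′ K.* basis k′ l′ m n))
        ≡⟨ linearMap-T (S-coefficient (i , j)) m n k l ⟨
      entry (S (T (+ m , + n)) (i , j)) k l ∎)
  invariant (-[1+ m ] , n) (i , j) = ≡.trans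
    (≡.cong (λ u → T (u , + p ℤ.* n ℤ.+ + toℕ j)) (proj₂ (⊛-neg (Fin.toℕ<n i) m)))
    (≡.sym (linearMap-0 p (S-coefficient (i , j))))
  invariant (+ m , -[1+ n ]) (i , j) = ≡.trans
    (≡.cong (λ v → T (+ p ℤ.* + m ℤ.+ + toℕ i , v)) (proj₂ (⊛-neg (Fin.toℕ<n j) n)))
    (≡.trans (T-negʳ (+ p ℤ.* + m ℤ.+ + toℕ i) (proj₁ (⊛-neg (Fin.toℕ<n j) n)))
      (≡.sym (linearMap-0 p (S-coefficient (i , j)))))

  F : Fin (suc d) → Fin (suc d) → Series²
  F i j m n = entry (M (+ m , + n)) i j

  vanishes : ∀ α → ¬ InQuadrant α → ∀ i j → entry (M α) i j ≡ K.0#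
  vanishes α α∉ℕ² i j = ≡.trans (≡.cong (λ A → entry A i j) (M-outside α α∉ℕ²)) (entry-0 p i j)

  -- On the edge m = 0 both sides vanish: a multiple of x has no term there, and the left neighbour
  -- lies outside the quadrant.
  x-shift : ∀ i j m n → (x *ˢ F i j) m n ≡ entry (M (+ m ℤ.- 1ℤ , + n)) i j
  x-shift i j zero    n = ≡.trans (x-*-zero (F i j) n)
    (≡.sym (vanishes (-[1+ 0 ] , + n) (λ { (() , _) }) i j))
  x-shift i j (suc m) n = x-* (F i j) m n

  y-shift : ∀ i j m n → (y *ˢ F i j) m n ≡ entry (M (+ m , + n ℤ.- 1ℤ)) i j
  y-shift i j m zero    = ≡.trans (y-*-zero (F i j) m)
    (≡.sym (vanishes (+ m , -[1+ 0 ]) (λ { (_ , ()) }) i j))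
  y-shift i j m (suc n) = y-* (F i j) m n

  xy-shift : ∀ i j m n → (x *ˢ (y *ˢ F i j)) m n ≡ entry (M (+ m ℤ.- 1ℤ , + n ℤ.- 1ℤ)) i j
  xy-shift i j zero    n = ≡.trans (x-*-zero (y *ˢ F i j) n)
    (≡.sym (vanishes (-[1+ 0 ] , + n ℤ.- 1ℤ) (λ { (() , _) }) i j))
  xy-shift i j (suc m) n = ≡.trans (x-* (y *ˢ F i j) m n) (y-shift i j m n)

  step-sum : ∀ i j m n → Σ (λ k → (step i k *ˢ F k j) m n) ≡
             entry (a *ᴹ M (+ m ℤ.- 1ℤ , + n) +ᴹ b *ᴹ M (+ m , + n ℤ.- 1ℤ)
                    +ᴹ c *ᴹ M (+ m ℤ.- 1ℤ , + n ℤ.- 1ℤ)) i j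
  step-sum i j m n = begin
    Σ (λ k → (step i k *ˢ F k j) m n)
      ≡⟨ sum-cong-≗ {suc d} (λ k → ≡.trans (step-* i k (F k j) m n)
           (≡.cong₂ K._+_ (≡.cong₂ (λ u v → entry a i k K.* u K.+ entry b i k K.* v)
             (x-shift k j m n) (y-shift k j m n))
           (≡.cong (entry c i k K.*_) (xy-shift k j m n)))) ⟩
    Σ (λ k → A k K.+ B k K.+ C k)
      ≡⟨ ≡.trans (∑-distrib-+ {suc d} (λ k → A k K.+ B k) C)
           (≡.cong (K._+ Σ C) (∑-distrib-+ {suc d} A B)) ⟩
    Σ A K.+ Σ B K.+ Σ C
      ≡⟨ ≡.cong₂ K._+_ (≡.cong₂ K._+_ (entry-* p a Mx i j) (entry-* p b My i j))
           (entry-* p c Mxy i j) ⟨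
    entry (a *ᴹ Mx) i j K.+ entry (b *ᴹ My) i j K.+ entry (c *ᴹ Mxy) i j
      ≡⟨ ≡.trans (entry-+ p (a *ᴹ Mx +ᴹ b *ᴹ My) (c *ᴹ Mxy) i j)
           (≡.cong (K._+ entry (c *ᴹ Mxy) i j) (entry-+ p (a *ᴹ Mx) (b *ᴹ My) i j)) ⟨
    entry (a *ᴹ Mx +ᴹ b *ᴹ My +ᴹ c *ᴹ Mxy) i j ∎
    where
    Mx Mxy My : Mat (𝔽 p) (suc d)
    Mx  = M (+ m ℤ.- 1ℤ , + n)
    My  = M (+ m , + n ℤ.- 1ℤ)
    Mxy = M (+ m ℤ.- 1ℤ , + n ℤ.- 1ℤ)
    A B C : Fin (suc d) → Fin p
    A k = entry a i k K.* entry Mx k j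
    B k = entry b i k K.* entry My k j
    C k = entry c i k K.* entry Mxy k j

  off-origin : ∀ i j m n → (+ m , + n) ≢ (0ℤ , 0ℤ) → unit i j m n ≡ K.0# →
               F i j m n ≡ unit i j m n K.+ Σ (λ k → (step i k *ˢ F k j) m n)
  off-origin i j m n ≢0 unit≡0 = begin
    F i j m n
      ≡⟨ ≡.cong (λ A → entry A i j) (recurrence (+ m) (+ n) (ℤ.+≤+ z≤n , ℤ.+≤+ z≤n) ≢0) ⟩
    _
      ≡⟨ step-sum i j m n ⟨
    Σ (λ k → (step i k *ˢ F k j) m n)
      ≡⟨ K.+-identityˡ _ ⟨
    K.0# K.+ Σ (λ k → (step i k *ˢ F k j) m n)
      ≡⟨ ≡.cong (K._+ Σ (λ k → (step i k *ˢ F k j) m n)) unit≡0 ⟨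
    unit i j m n K.+ Σ (λ k → (step i k *ˢ F k j) m n) ∎

  F-coefficient : ∀ i j m n → F i j m n ≡ unit i j m n K.+ Σ (λ k → (step i k *ˢ F k j) m n)
  F-coefficient i j zero zero = begin
    F i j 0 0
      ≡⟨ ≡.trans (≡.cong (λ A → entry A i j) origin)
           (entry-matrix p (Exterior.unit (𝔽-commutativeRing p)) i j) ⟩
    Exterior.unit (𝔽-commutativeRing p) i j
      ≡⟨ unit-constant i j ⟨
    unit i j 0 0
      ≡⟨ K.+-identityʳ (unit i j 0 0) ⟨
    unit i j 0 0 K.+ K.0#
      ≡⟨ ≡.cong (unit i j 0 0 K.+_) (≡.trans (sum-cong-≗ {suc d} λ k →
           ≡.trans (≡.cong (K._* F k j 0 0) (step-constant i k)) (K.zeroˡ (F k j 0 0)))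
           (sum-replicate-zero (suc d))) ⟨
    unit i j 0 0 K.+ Σ (λ k → (step i k *ˢ F k j) 0 0) ∎
  F-coefficient i j zero (suc n) = off-origin i j 0 (suc n) (λ ()) (unit-yCoefficient i j n)
  F-coefficient i j (suc m) n    = off-origin i j (suc m) n (λ ()) (unit-xCoefficient i j m n)

  F-recurrence : ∀ i j → F i j ≈ˢ unit i j +ˢ Σˢ (λ k → step i k *ˢ F k j)
  F-recurrence i j m n = ≡.trans (F-coefficient i j m n)
    (≡.cong (unit i j m n K.+_) (≡.sym (sum-coefficient (suc d) (λ k → step i k *ˢ F k j) m n)))

  τ-coefficient : (i j k l : Fin (suc d)) → Fin p
  τ-coefficient i j k l = adjugate i j (toℕ k) (toℕ l)

  τ : Mat (𝔽 p) (suc d) → Mat (𝔽 p) (suc d)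
  τ = linearMap p τ-coefficient

  M≗τ∘T : M ≗ τ ∘ T
  M≗τ∘T (+ m , + n) = matrix-ext p λ i j →
    ≡.trans (F-expansion F F-recurrence i j m n) (≡.sym (linearMap-T τ-coefficient m n i j))
  M≗τ∘T (-[1+ m ] , n)    = ≡.trans (M-outside _ λ { (() , _) }) (≡.sym (linearMap-0 p τ-coefficient))
  M≗τ∘T (+ m , -[1+ n ]) = ≡.trans (M-outside _ λ { (_ , ()) }) (≡.sym (linearMap-0 p τ-coefficient))
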